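{- Let $X$ be a connected $k$-regular triangle-free graph on $n\ge5$ vertices, where $k\ge3$. Suppose $\mathfrak{X}$ is an association scheme of rank $4$ and diameter $2$ on the vertex set $E(X)=V(L(X))$, such that one of its constituents equals the line graph $L(X)$ and is not strongly regular. Then every pair of distinct vertices $u,v$ of $X$ is distinguished in $X$ by at least $n/8$ vertices of $X$. Consequently, $|\mathrm{Aut}(L(X))|\le n^{O(\log n)}$ (with an absolute implied constant), and the motion of $L(X)$ is at least $|V(L(X))|/16$.
   Context: An association scheme of rank $r$ on a finite vertex set $V$ is a surjective map $c:V\times V\to\{0,\dots,r-1\}$ such that $c(u,v)=0$ iff $u=v$, $c(u,v)=c(v,u)$, and for all colors $i,j,t$ there is an integer $p^t_{i,j}$ such that whenever $c(u,v)=t$ there are exactly $p^t_{i,j}$ vertices $w$ with $c(u,w)=i$, $c(w,v)=j$. Its constituent $X_i$ is the graph on $V$ with distinct $u,v$ adjacent iff $c(u,v)=i$; the scheme has diameter $2$ if every $X_i$ ($i\ne 0$) has diameter at most $2$ and some has diameter exactly $2$. The line graph $L(X)$ has vertex set $E(X)$, two edges adjacent iff they share an endpoint. In a graph $X$, a vertex $x$ distinguishes vertices $u,v$ if $x\in\{u,v\}$ or $x$ is adjacent to exactly one of $u,v$. The motion of a graph is the minimum number of vertices moved by a non-identity automorphism (the number of vertices if the automorphism group is trivial). -}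

module Defs where

open import Data.Nat using (ℕ; zero; suc; _+_; _*_; _^_; _≤_; _<ᵇ_)
open import Data.Fin using (Fin; toℕ; _≟_)
open import Data.Bool using (Bool; true; false; _∧_; _∨_; _xor_; not; if_then_else_)
open import Data.List using (List; []; _∷_; map; concatMap; allFin; filterᵇ; length; lookup)
open import Data.List.Relation.Unary.AllPairs using (AllPairs)
open import Data.Product using (_×_; _,_; proj₁; proj₂; Σ; ∃; ∃-syntax)
open import Relation.Binary.PropositionalEquality using (_≡_; _≢_)
open import Relation.Nullary.Decidable using (⌊_⌋)
open import Function.Definitions using (Injective)
open import Data.Sum using (_⊎_)
open import Data.List.Relation.Unary.All using (All)

Adj : ℕ → Set
Adj n = Fin n → Fin n → Bool

_==_ : ∀ {n} → Fin n → Fin n → Bool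
u == v = ⌊ u ≟ v ⌋

IsSimple : ∀ {n} → Adj n → Set
IsSimple {n} A = (∀ u → A u u ≡ false) × (∀ u v → A u v ≡ A v u)

count : ∀ {n} → (Fin n → Bool) → ℕ
count {zero} f = 0
count {suc n} f = (if f Fin.zero then 1 else 0) + count {n} (λ x → f (Fin.suc x))

IsRegular : ∀ {n} → Adj n → ℕ → Set
IsRegular A k = ∀ u → count (A u) ≡ k

TriangleFree : ∀ {n} → Adj n → Set
TriangleFree A = ∀ u v w → A u v ≡ true → A v w ≡ true → A u w ≡ false

data Walk {n} (A : Adj n) : Fin n → Fin n → Set where
  stop : ∀ {u} → Walk A u u
  step : ∀ {u w v} → A u w ≡ true → Walk A w v → Walk A u v

Connected : ∀ {n} → Adj n → Set
Connected A = ∀ u v → Walk A u v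

edges : ∀ {n} → Adj n → List (Fin n × Fin n)
edges {n} A =
  filterᵇ (λ p → (toℕ (proj₁ p) <ᵇ toℕ (proj₂ p)) ∧ A (proj₁ p) (proj₂ p))
          (concatMap (λ u → map (λ v → (u , v)) (allFin n)) (allFin n))

nE : ∀ {n} → Adj n → ℕ
nE A = length (edges A)

edge : ∀ {n} (A : Adj n) → Fin (nE A) → Fin n × Fin n
edge A = lookup (edges A)

lineGraph : ∀ {n} (A : Adj n) → Adj (nE A)
lineGraph A e f =
  not (e == f) ∧
  ((proj₁ (edge A e) == proj₁ (edge A f)) ∨ (proj₁ (edge A e) == proj₂ (edge A f)) ∨
   (proj₂ (edge A e) == proj₁ (edge A f)) ∨ (proj₂ (edge A e) == proj₂ (edge A f)))

record IsAssocScheme {m} (r : ℕ) (c : Fin m → Fin m → Fin r) : Set where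
  field
    surj : ∀ (i : Fin r) → ∃[ u ] ∃[ v ] c u v ≡ i
    zero-iff-diag₁ : ∀ u v → toℕ (c u v) ≡ 0 → u ≡ v
    zero-iff-diag₂ : ∀ u → toℕ (c u u) ≡ 0
    symm : ∀ u v → c u v ≡ c v u
    regularity : ∀ (i j t : Fin r) → ∃[ p ] ∀ u v → c u v ≡ t →
                   count (λ w → (c u w == i) ∧ (c w v == j)) ≡ p

constituent : ∀ {m r} → (Fin m → Fin m → Fin r) → Fin r → Adj m
constituent c i u v = not (u == v) ∧ (c u v == i)

Dist≤2 : ∀ {n} → Adj n → Fin n → Fin n → Set
Dist≤2 A u v = (u ≡ v) ⊎ (A u v ≡ true) ⊎ (∃[ w ] (A u w ≡ true × A w v ≡ true))

DiamAtMost2 : ∀ {n} → Adj n → Set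
DiamAtMost2 A = ∀ u v → Dist≤2 A u v

Diam2 : ∀ {n} → Adj n → Set
Diam2 A = DiamAtMost2 A × ∃[ u ] ∃[ v ] (u ≢ v × A u v ≡ false)

HasDiameter2 : ∀ {m r} → (Fin m → Fin m → Fin r) → Set
HasDiameter2 {r = r} c =
  (∀ (i : Fin r) → toℕ i ≢ 0 → DiamAtMost2 (constituent c i)) ×
  ∃[ i ] (toℕ i ≢ 0 × Diam2 (constituent c i))

common : ∀ {n} → Adj n → Fin n → Fin n → ℕ
common A u v = count (λ w → A u w ∧ A w v)

StronglyRegular : ∀ {n} → Adj n → Set
StronglyRegular A = ∃[ k ] ∃[ λ' ] ∃[ μ ]
  (IsRegular A k ×
   (∀ u v → A u v ≡ true → common A u v ≡ λ') ×
   (∀ u v → u ≢ v → A u v ≡ false → common A u v ≡ μ))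

distinguishes : ∀ {n} → Adj n → Fin n → Fin n → Fin n → Bool
distinguishes A u v x = (x == u) ∨ (x == v) ∨ (A x u xor A x v)

IsAut : ∀ {n} → Adj n → (Fin n → Fin n) → Set
IsAut A σ = Injective _≡_ _≡_ σ × (∀ u v → A (σ u) (σ v) ≡ A u v)

-- |Aut(A)| ≤ N : every list of pairwise distinct automorphisms has length ≤ N
AutBound : ∀ {n} → Adj n → ℕ → Set
AutBound {n} A N = ∀ (L : List (Fin n → Fin n)) →
  All (IsAut A) L → AllPairs (λ σ τ → ∃[ x ] σ x ≢ τ x) L → length L ≤ N

-- motion(A) ≥ t, in the scaled form: s * motion(A) ≥ n with s the divisor.
-- Every non-identity automorphism moves at least n/s vertices
-- (if Aut is trivial, motion = n ≥ n/s holds automatically).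
MotionAtLeastFrac : ∀ {n} → Adj n → ℕ → Set
MotionAtLeastFrac {n} A s = ∀ σ → IsAut A σ → ∃[ x ] σ x ≢ x →
  n ≤ s * count (λ x → not (σ x == x))

{-# OPTIONS --safe #-}
module Submission where

open import Defs
open import Data.Bool using (Bool; true; false; T?; _∧_; _∨_; _xor_; not; if_then_else_)
open import Data.Bool.Properties using (¬-not; ∧-zeroʳ; T-≡)
open import Data.Empty using (⊥; ⊥-elim)
open import Data.Fin using (Fin; toℕ; fromℕ<; _≟_; punchOut; combine; remQuot; funToFin; finToFun)
open import Data.Fin.Patterns using (0F; 1F; 2F; 3F)
open import Data.Fin.Properties using (any?; toℕ-injective; punchOut-injective; injective⇒≤; remQuot-combine; finToFun-funToFin)
open import Data.List as List using (List; length; map; concatMap; allFin)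
open import Data.List.Membership.Propositional using (_∈_; lose)
open import Data.List.Membership.Propositional.Properties using (∈-filter⁺; ∈-filter⁻; ∈-concatMap⁺; ∈-map⁺; ∈-map⁻; ∈-allFin; ∈-lookup)
open import Data.List.Relation.Unary.All as All using (All)
import Data.List.Relation.Unary.All.Properties as All
open import Data.List.Relation.Unary.AllPairs as AllPairs using (AllPairs; _∷_)
import Data.List.Relation.Unary.AllPairs.Properties as AllPairs
open import Data.List.Relation.Unary.Any using (index)
open import Data.List.Relation.Unary.Any.Properties using (lookup-index)
open import Data.List.Relation.Unary.Unique.Propositional using (Unique)
import Data.List.Relation.Unary.Unique.Propositional.Properties as Unique
open import Data.Nat as ℕ using (ℕ; zero; suc; _+_; _*_; _∸_; _^_; _≤_; _<_; _<ᵇ_; z≤n; s≤s; _≤?_; NonZero; >-nonZero; ⌈_/2⌉; ⌊_/2⌋)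
open import Data.Nat.Induction using (<-wellFounded)
open import Data.Nat.Logarithm using (⌈log₂_⌉)
open import Data.Nat.Logarithm.Core using (⌈log2⌉)
open import Data.Nat.Properties hiding (_≟_; _≤?_)
open import Data.Nat.Solver using (module +-*-Solver)
open import Data.Product using (_×_; _,_; proj₁; proj₂; ∃-syntax)
open import Data.Product.Properties using (≡-dec; ,-injectiveˡ; ,-injectiveʳ)
open import Data.Sum using (_⊎_; inj₁; inj₂; [_,_]′; swap)
open import Data.Vec using (Vec; []; _∷_; lookup)
open import Function using (_∘_; Equivalence)
open import Function.Definitions using (Injective)
open import Induction.WellFounded using (Acc; acc)
open import Relation.Binary using (Decidable; tri<; tri≈; tri>)
open import Relation.Binary.PropositionalEquality
open import Relation.Nullary using (¬_; Dec; yes; no; contradiction)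
open import Relation.Nullary.Decidable using (⌊_⌋; _⊎-dec_)
open import Algebra.Properties.Semiring.Sum +-*-semiring using (sum; *-distribˡ-sum; ∑-comm; sum-cong-≗; sum-replicate-zero; ∑-distrib-+)

-- Two disjoint edges of X are joined by one or two edges, since L(X) has diameter 2 and
-- X has no triangle. As L(X) is not strongly regular, exactly one colour j of the scheme
-- collects the pairs joined by two edges. Counting, for the adjacent edges ab and ac, the
-- neighbours of ab in L(X) that have colour j with ac shows that b and c have a constant
-- number μ of common neighbours, and X turns out to have diameter 2. An edge
-- avoiding the closed neighbourhood of a vertex exists (else L(X) would be strongly
-- regular), whence 2μ ≤ k; the vertices far from an edge form an independent set, whence
-- n ≤ 4k. So |N(u) ∖ N(v)| ≥ k/2 ≥ n/8 for u ≠ v.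
--
-- Automorphisms of L(X) map stars to stars and hence come from automorphisms of X, which
-- are determined by their values on a greedily chosen set of O(log n) vertices separating
-- all pairs. A nontrivial one moves at least n/8 vertices, and a moved vertex lies on at
-- most one fixed edge.

-- Booleans, equality on `Fin`, and injective self-maps.

true≢false : ∀ {b} → b ≡ true → b ≡ false → ⊥
true≢false refl ()

bool-ext : ∀ {a b} → (a ≡ true → b ≡ true) → (b ≡ true → a ≡ true) → a ≡ b
bool-ext {true}  {b}     f g = sym (f refl)
bool-ext {false} {true}  f g = g refl
bool-ext {false} {false} f g = refl

∧-true : ∀ {a b} → a ≡ true → b ≡ true → a ∧ b ≡ true
∧-true refl refl = refl

true-∧ : ∀ {a b} → a ∧ b ≡ true → a ≡ true × b ≡ true
true-∧ {true} {true} _ = refl , refl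

true-∨ : ∀ {a b} → a ∨ b ≡ true → a ≡ true ⊎ b ≡ true
true-∨ {true}  p = inj₁ refl
true-∨ {false} p = inj₂ p

∨-trueˡ : ∀ {a b} → a ≡ true → a ∨ b ≡ true
∨-trueˡ refl = refl

∨-trueʳ : ∀ {a b} → b ≡ true → a ∨ b ≡ true
∨-trueʳ {true}  _ = refl
∨-trueʳ {false} p = p

⌊⌋-true : ∀ {P : Set} (P? : Dec P) → ⌊ P? ⌋ ≡ true → P
⌊⌋-true (yes p) _ = p

true-⌊⌋ : ∀ {P : Set} (P? : Dec P) → P → ⌊ P? ⌋ ≡ true
true-⌊⌋ (yes _) _ = refl
true-⌊⌋ (no ¬p) p = contradiction p ¬p

false-⌊⌋ : ∀ {P : Set} (P? : Dec P) → ¬ P → ⌊ P? ⌋ ≡ false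
false-⌊⌋ (yes p) ¬p = contradiction p ¬p
false-⌊⌋ (no _)  _  = refl

==-refl : ∀ {n} (u : Fin n) → (u == u) ≡ true
==-refl u = true-⌊⌋ (u ≟ u) refl

==-true : ∀ {n} {u v : Fin n} → (u == v) ≡ true → u ≡ v
==-true {u = u} {v} = ⌊⌋-true (u ≟ v)

≢-not== : ∀ {n} {u v : Fin n} → u ≢ v → not (u == v) ≡ true
≢-not== {u = u} {v} u≢v = cong not (false-⌊⌋ (u ≟ v) u≢v)

not==-≢ : ∀ {n} {u v : Fin n} → not (u == v) ≡ true → u ≢ v
not==-≢ {u = u} p refl rewrite ==-refl u with p
... | ()

-- Punching out a missed value `y` would inject a set of `suc n` elements into one of `n`.
injective⇒surjective : ∀ {n} (f : Fin n → Fin n) → Injective _≡_ _≡_ f → ∀ y → ∃[ x ] f x ≡ y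
injective⇒surjective {suc n} f inj y with any? (λ x → f x ≟ y)
... | yes hit = hit
... | no miss = contradiction
  (injective⇒≤ {f = λ x → punchOut {i = y} (λ eq → miss (x , sym eq))}
    (λ {x} {x′} eq → inj (punchOut-injective (λ e → miss (x , sym e)) (λ e → miss (x′ , sym e)) eq)))
  1+n≰n

-- Counting over Fin

private
  𝟙 : Bool → ℕ
  𝟙 b = if b then 1 else 0

count≡sum : ∀ {n} (f : Fin n → Bool) → count f ≡ sum (λ x → 𝟙 (f x))
count≡sum {zero}  f = refl
count≡sum {suc n} f = cong (𝟙 (f Fin.zero) +_) (count≡sum (f ∘ Fin.suc))

sum-mono : ∀ {n} {f g : Fin n → ℕ} → (∀ x → f x ≤ g x) → sum f ≤ sum g
sum-mono {zero}  h = z≤n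
sum-mono {suc n} h = +-mono-≤ (h Fin.zero) (sum-mono (h ∘ Fin.suc))

count-cong : ∀ {n} {f g : Fin n → Bool} → (∀ x → f x ≡ g x) → count f ≡ count g
count-cong {zero}  h = refl
count-cong {suc n} h = cong₂ (λ b c → 𝟙 b + c) (h Fin.zero) (count-cong (h ∘ Fin.suc))

count-mono : ∀ {n} {f g : Fin n → Bool} → (∀ x → f x ≡ true → g x ≡ true) → count f ≤ count g
count-mono {zero}  h = z≤n
count-mono {suc n} {f} {g} h = +-mono-≤ head (count-mono (λ x → h (Fin.suc x)))
  where
  head : 𝟙 (f Fin.zero) ≤ 𝟙 (g Fin.zero)
  head with f Fin.zero | h Fin.zero
  ... | false | _ = z≤n
  ... | true  | p rewrite p refl = ≤-refl

count-true : ∀ n → count {n} (λ _ → true) ≡ n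
count-true zero    = refl
count-true (suc n) = cong suc (count-true n)

count-bound : ∀ {n} (f : Fin n → Bool) → count f ≤ n
count-bound {n} f = subst (count f ≤_) (count-true n) (count-mono {f = f} {g = λ _ → true} (λ _ _ → refl))

count-split : ∀ {n} (f g : Fin n → Bool) →
              count f ≡ count (λ x → f x ∧ g x) + count (λ x → f x ∧ not (g x))
count-split {n} f g = begin
  count f
    ≡⟨ count≡sum f ⟩
  sum (λ x → 𝟙 (f x))
    ≡⟨ sum-cong-≗ pointwise ⟩
  sum (λ x → 𝟙 (f x ∧ g x) + 𝟙 (f x ∧ not (g x)))
    ≡⟨ ∑-distrib-+ (λ x → 𝟙 (f x ∧ g x)) (λ x → 𝟙 (f x ∧ not (g x))) ⟩
  sum (λ x → 𝟙 (f x ∧ g x)) + sum (λ x → 𝟙 (f x ∧ not (g x)))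
    ≡⟨ cong₂ _+_ (count≡sum (λ x → f x ∧ g x)) (count≡sum (λ x → f x ∧ not (g x))) ⟨
  count (λ x → f x ∧ g x) + count (λ x → f x ∧ not (g x)) ∎
  where
  open ≡-Reasoning
  pointwise : ∀ x → 𝟙 (f x) ≡ 𝟙 (f x ∧ g x) + 𝟙 (f x ∧ not (g x))
  pointwise x with f x | g x
  ... | false | _     = refl
  ... | true  | true  = refl
  ... | true  | false = refl

count-false : ∀ n → count {n} (λ _ → false) ≡ 0
count-false zero    = refl
count-false (suc n) = count-false n

count-== : ∀ {n} (a : Fin n) → count (_== a) ≡ 1
count-== {suc n} Fin.zero    = cong suc (count-false n)
count-== {suc n} (Fin.suc a) = trans (count-cong suc-==) (count-== a)
  where
  suc-== : ∀ x → (Fin.suc x == Fin.suc a) ≡ (x == a)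
  suc-== x with x ≟ a
  ... | yes _ = refl
  ... | no  _ = refl

count-remove-≤ : ∀ {n} (f : Fin n → Bool) a → count f ≤ 1 + count (λ x → f x ∧ not (x == a))
count-remove-≤ f a = begin
  count f                                ≡⟨ count-split f (_== a) ⟩
  count (λ x → f x ∧ (x == a)) + rest    ≤⟨ +-monoˡ-≤ rest (count-mono (λ x p → proj₂ (true-∧ {f x} p))) ⟩
  count (_== a) + rest                   ≡⟨ cong (_+ rest) (count-== a) ⟩
  1 + rest                               ∎
  where
  open ≤-Reasoning
  rest : ℕ
  rest = count (λ x → f x ∧ not (x == a))

count-remove : ∀ {n} (f : Fin n → Bool) a → f a ≡ true →
               count f ≡ 1 + count (λ x → f x ∧ not (x == a))
count-remove f a fa = trans (count-split f (_== a)) (cong (_+ count (λ x → f x ∧ not (x == a))) (trans (count-cong eq) (count-== a)))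
  where
  eq : ∀ x → f x ∧ (x == a) ≡ (x == a)
  eq x = bool-ext (λ p → proj₂ (true-∧ {f x} p)) λ p → ∧-true (trans (cong f (==-true p)) fa) p

count-∃ : ∀ {n} (f : Fin n → Bool) → 1 ≤ count f → ∃[ x ] f x ≡ true
count-∃ {suc n} f p with f Fin.zero in eq
... | true = Fin.zero , eq
... | false with x , q ← count-∃ (f ∘ Fin.suc) p = Fin.suc x , q

count-∃₁ : ∀ {n} (f : Fin n → Bool) a → 2 ≤ count f → ∃[ x ] (f x ≡ true × x ≢ a)
count-∃₁ f a p
  with x , q ← count-∃ _ (≤-pred (≤-trans p (count-remove-≤ f a)))
  with fx , ne ← true-∧ {f x} q = x , fx , not==-≢ ne

count-∃₂ : ∀ {n} (f : Fin n → Bool) a b → 3 ≤ count f → ∃[ x ] (f x ≡ true × x ≢ a × x ≢ b)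
count-∃₂ f a b p
  with x , q , x≢b ← count-∃₁ _ b (≤-pred (≤-trans p (count-remove-≤ f a)))
  with fx , ne ← true-∧ {f x} q = x , fx , not==-≢ ne , x≢b

count-pos : ∀ {n} (f : Fin n → Bool) a → f a ≡ true → 1 ≤ count f
count-pos f a fa = subst (1 ≤_) (sym (count-remove f a fa)) (s≤s z≤n)

count≡1 : ∀ {n} (f : Fin n → Bool) a → f a ≡ true → (∀ x → f x ≡ true → x ≡ a) → count f ≡ 1
count≡1 f a fa uniq = trans (count-cong eq) (count-== a)
  where
  eq : ∀ x → f x ≡ (x == a)
  eq x = bool-ext (λ p → true-⌊⌋ (x ≟ a) (uniq x p)) (λ p → trans (cong f (==-true p)) fa)

count≡2 : ∀ {n} (f : Fin n → Bool) a b → a ≢ b → f a ≡ true → f b ≡ true →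
          (∀ x → f x ≡ true → x ≡ a ⊎ x ≡ b) → count f ≡ 2
count≡2 f a b a≢b fa fb uniq = trans (count-remove f a fa) (cong suc
  (count≡1 _ b (∧-true fb (≢-not== (a≢b ∘ sym))) λ x p → rest x (true-∧ {f x} p)))
  where
  rest : ∀ x → f x ≡ true × not (x == a) ≡ true → x ≡ b
  rest x (fx , ne) = [ (λ x≡a → contradiction x≡a (not==-≢ ne)) , (λ x≡b → x≡b) ]′ (uniq x fx)

count≤1 : ∀ {n} (f : Fin n → Bool) → (∀ x y → f x ≡ true → f y ≡ true → x ≡ y) → count f ≤ 1
count≤1 f uniq with count f ≤? 1
... | yes p = p
... | no ¬p
  with x , fx ← count-∃ f (≤-trans (s≤s z≤n) (≰⇒> ¬p))
  with y , fy , y≢x ← count-∃₁ f x (≰⇒> ¬p) = contradiction (uniq y x fy fx) y≢x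

count≤2 : ∀ {n} (f : Fin n → Bool) a b → (∀ x → f x ≡ true → x ≡ a ⊎ x ≡ b) → count f ≤ 2
count≤2 f a b among = ≤-trans (count-remove-≤ f a) (s≤s
  (≤-trans (count-mono {g = _== b} λ x p → rest x (true-∧ {f x} p)) (≤-reflexive (count-== b))))
  where
  rest : ∀ x → f x ≡ true × not (x == a) ≡ true → (x == b) ≡ true
  rest x (fx , ne) = true-⌊⌋ (x ≟ b)
    ([ (λ x≡a → contradiction x≡a (not==-≢ ne)) , (λ x≡b → x≡b) ]′ (among x fx))

2≤count : ∀ {n} (f : Fin n → Bool) a b → a ≢ b → f a ≡ true → f b ≡ true → 2 ≤ count f
2≤count f a b a≢b fa fb = subst (2 ≤_) (sym (count-remove f a fa))
  (s≤s (count-pos _ b (∧-true fb (≢-not== (a≢b ∘ sym)))))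

-- Both sides are compared with `s` times the number of `R`-related pairs in `P × Q`, summed by rows
-- and then by columns. The factor `s` clears denominators, as in a lower bound of `n/8` per row.
double-count : ∀ {m n} s a b (P : Fin m → Bool) (Q : Fin n → Bool) (R : Fin m → Fin n → Bool) →
  (∀ x → P x ≡ true → a ≤ s * count (λ y → Q y ∧ R x y)) →
  (∀ y → Q y ≡ true → s * count (λ x → P x ∧ R x y) ≤ b) →
  a * count P ≤ b * count Q
double-count {m} {n} s a b P Q R lower upper = begin
  a * count P                                  ≡⟨ cong (a *_) (count≡sum P) ⟩
  a * sum (λ x → 𝟙 (P x))                      ≡⟨ *-distribˡ-sum a (λ x → 𝟙 (P x)) ⟩
  sum (λ x → a * 𝟙 (P x))                      ≤⟨ sum-mono row ⟩
  sum (λ x → s * sum (λ y → M x y))            ≡⟨ *-distribˡ-sum s (λ x → sum (M x)) ⟨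
  s * sum (λ x → sum (λ y → M x y))            ≡⟨ cong (s *_) (∑-comm M) ⟩
  s * sum (λ y → sum (λ x → M x y))            ≡⟨ *-distribˡ-sum s (λ y → sum (λ x → M x y)) ⟩
  sum (λ y → s * sum (λ x → M x y))            ≤⟨ sum-mono column ⟩
  sum (λ y → b * 𝟙 (Q y))                      ≡⟨ *-distribˡ-sum b (λ y → 𝟙 (Q y)) ⟨
  b * sum (λ y → 𝟙 (Q y))                      ≡⟨ cong (b *_) (count≡sum Q) ⟨
  b * count Q                                  ∎
  where
  open ≤-Reasoning
  M : Fin m → Fin n → ℕ
  M x y = 𝟙 (P x ∧ (Q y ∧ R x y))
  row : ∀ x → a * 𝟙 (P x) ≤ s * sum (M x)
  row x with P x | lower x
  ... | false | _ = ≤-trans (≤-reflexive (*-zeroʳ a)) z≤n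
  ... | true  | h = subst₂ _≤_ (sym (*-identityʳ a)) (cong (s *_) (count≡sum (λ y → Q y ∧ R x y))) (h refl)
  column : ∀ y → s * sum (λ x → M x y) ≤ b * 𝟙 (Q y)
  column y with Q y | upper y
  ... | false | _ = ≤-trans (≤-reflexive (trans (cong (s *_) vanish) (*-zeroʳ s))) z≤n
    where
    vanish : sum (λ x → 𝟙 (P x ∧ false)) ≡ 0
    vanish = trans (sum-cong-≗ (λ x → cong 𝟙 (∧-zeroʳ (P x)))) (sum-replicate-zero m)
  ... | true  | h = subst₂ _≤_ (cong (s *_) (count≡sum (λ x → P x ∧ R x y))) (sym (*-identityʳ b)) (h refl)

-- A double count with all constants 1. The injection is given as a relation `R`, so that one and
-- the same relation between edges and vertices can be used in both directions.
count-injection : ∀ {m n} {P : Fin m → Bool} {Q : Fin n → Bool} {R : Fin m → Fin n → Set} →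
  Decidable R →
  (∀ x → P x ≡ true → ∃[ y ] (Q y ≡ true × R x y)) →
  (∀ x x′ y → R x y → R x′ y → x ≡ x′) →
  count P ≤ count Q
count-injection {P = P} {Q} {R} R? image injective =
  subst₂ _≤_ (*-identityˡ _) (*-identityˡ _)
    (double-count 1 1 1 P Q (λ x y → ⌊ R? x y ⌋)
      (λ x Px → subst (1 ≤_) (sym (*-identityˡ _)) (hit x (image x Px)))
      (λ y _ → subst (_≤ 1) (sym (*-identityˡ _)) (count≤1 _ λ x x′ p p′ →
        injective x x′ y (related x y p) (related x′ y p′))))
  where
  related : ∀ x y → P x ∧ ⌊ R? x y ⌋ ≡ true → R x y
  related x y p = ⌊⌋-true (R? x y) (proj₂ (true-∧ {P x} p))
  hit : ∀ x → ∃[ y ] (Q y ≡ true × R x y) → 1 ≤ count (λ y → Q y ∧ ⌊ R? x y ⌋)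
  hit x (y , Qy , r) = count-pos _ y (∧-true Qy (true-⌊⌋ (R? x y) r))

-- Greedy covering

-- The induction follows the accessibility argument on which `⌈log2⌉` recurses, where each call
-- replaces the number by half of it, rounded up.
n≤2^⌈log₂n⌉ : ∀ n → n ≤ 2 ^ ⌈log₂ n ⌉
n≤2^⌈log₂n⌉ n = go n (<-wellFounded n)
  where
  open ≤-Reasoning
  half : ∀ n → n ≤ 2 * ⌈ n /2⌉
  half n = begin
    n                       ≡⟨ ⌊n/2⌋+⌈n/2⌉≡n n ⟨
    ⌊ n /2⌋ + ⌈ n /2⌉       ≤⟨ +-monoˡ-≤ ⌈ n /2⌉ (⌊n/2⌋≤⌈n/2⌉ n) ⟩
    ⌈ n /2⌉ + ⌈ n /2⌉       ≡⟨ cong (⌈ n /2⌉ +_) (+-identityʳ _) ⟨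
    2 * ⌈ n /2⌉             ∎
  go : ∀ n (a : Acc _<_ n) → n ≤ 2 ^ ⌈log2⌉ n a
  go 0             _        = z≤n
  go 1             _        = ≤-refl
  go (suc (suc n)) (acc rs) = ≤-trans (half (suc (suc n))) (*-monoʳ-≤ 2 (go (suc ⌈ n /2⌉) _))

-- Averaging: every `p` in `P` is covered by at least an eighth of all `x`, so some `x` covers at
-- least an eighth of `P`.
cover-step : ∀ {N n} (D : Fin N → Fin n → Bool) (P : Fin N → Bool) → Fin n →
  (∀ p → P p ≡ true → n ≤ 8 * count (D p)) →
  ∃[ x ] 8 * count (λ p → P p ∧ not (D p x)) ≤ 7 * count P
cover-step {N} {n} D P x₀ rich
  with any? (λ x → 8 * count (λ p → P p ∧ not (D p x)) ≤? 7 * count P)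
... | yes found = found
... | no none = contradiction total (λ t → <-irrefl refl (begin-strict
    n * c             ≤⟨ t ⟩
    (c ∸ 1) * count {n} (λ _ → true)   ≡⟨ cong ((c ∸ 1) *_) (count-true n) ⟩
    (c ∸ 1) * n       ≡⟨ *-comm (c ∸ 1) n ⟩
    n * (c ∸ 1)       <⟨ *-monoʳ-< n {{nonZero x₀}} (pred<c (few x₀)) ⟩
    n * c             ∎))
  where
  open ≤-Reasoning
  nonZero : ∀ {n} → Fin n → NonZero n
  nonZero {suc _} _ = _
  c : ℕ
  c = count P
  covered : Fin n → ℕ
  covered x = count (λ p → P p ∧ D p x)
  few : ∀ x → suc (8 * covered x) ≤ c
  -- Failure at `x` means `7c < 8 · rest`, and `covered x + rest = c`, so `8 · covered x < c`. This
  -- strictness supplies the bound `c ∸ 1` in `total`.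
  few x = +-cancelˡ-≤ (7 * c) _ _ (begin
    7 * c + suc (8 * covered x)   ≡⟨ +-suc (7 * c) _ ⟩
    suc (7 * c) + 8 * covered x   ≤⟨ +-monoˡ-≤ (8 * covered x) (≰⇒> (λ h → none (x , h))) ⟩
    8 * rest + 8 * covered x      ≡⟨ +-comm (8 * rest) _ ⟩
    8 * covered x + 8 * rest      ≡⟨ *-distribˡ-+ 8 (covered x) rest ⟨
    8 * (covered x + rest)        ≡⟨ cong (8 *_) (count-split P (λ p → D p x)) ⟨
    8 * c                         ≡⟨ +-comm c (7 * c) ⟩
    7 * c + c                     ∎)
    where
    rest : ℕ
    rest = count (λ p → P p ∧ not (D p x))
  pred<c : ∀ {a c} → suc a ≤ c → c ∸ 1 < c
  pred<c (s≤s _) = ≤-refl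
  total : n * c ≤ (c ∸ 1) * count {n} (λ _ → true)
  total = double-count 8 n (c ∸ 1) P (λ _ → true) D rich (λ x _ → ∸-monoˡ-≤ 1 (few x))

remaining : ∀ {N n t} → (Fin N → Fin n → Bool) → Vec (Fin n) t → (Fin N → Bool) → Fin N → Bool
remaining D []       P = P
remaining D (x ∷ xs) P = remaining D xs (λ p → P p ∧ not (D p x))

-- Each greedy choice leaves at most 7/8 of the uncovered points; the powers are multiplied out to
-- stay in ℕ.
cover-steps : ∀ {N n} (D : Fin N → Fin n → Bool) (P : Fin N → Bool) → Fin n →
  (∀ p → P p ≡ true → n ≤ 8 * count (D p)) → ∀ t →
  ∃[ xs ] 8 ^ t * count (remaining {t = t} D xs P) ≤ 7 ^ t * count P
cover-steps D P x₀ rich zero = [] , ≤-refl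
cover-steps D P x₀ rich (suc t)
  with x , hx ← cover-step D P x₀ rich
  with xs , hxs ← cover-steps D (λ p → P p ∧ not (D p x)) x₀ (λ p q → rich p (proj₁ (true-∧ q))) t
  = x ∷ xs , (begin
    8 * 8 ^ t * r           ≡⟨ *-assoc 8 (8 ^ t) r ⟩
    8 * (8 ^ t * r)         ≤⟨ *-monoʳ-≤ 8 hxs ⟩
    8 * (7 ^ t * c′)        ≡⟨ solve 3 (λ a b c → a :* (b :* c) := b :* (a :* c)) refl 8 (7 ^ t) c′ ⟩
    7 ^ t * (8 * c′)        ≤⟨ *-monoʳ-≤ (7 ^ t) hx ⟩
    7 ^ t * (7 * count P)   ≡⟨ solve 3 (λ a b c → a :* (b :* c) := b :* a :* c) refl (7 ^ t) 7 (count P) ⟩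
    7 * 7 ^ t * count P     ∎)
  where
  open ≤-Reasoning
  open +-*-Solver
  r c′ : ℕ
  r  = count (remaining D xs (λ p → P p ∧ not (D p x)))
  c′ = count (λ p → P p ∧ not (D p x))

remaining-empty : ∀ {N n t} (D : Fin N → Fin n → Bool) (xs : Vec (Fin n) t) (P : Fin N → Bool) p →
  P p ≡ true → remaining D xs P p ≡ false → ∃[ i ] D p (lookup xs i) ≡ true
remaining-empty D []       P p Pp none = contradiction none (true≢false Pp)
remaining-empty D (x ∷ xs) P p Pp none with D p x in eq
... | true  = Fin.zero , eq
... | false
  with i , q ← remaining-empty D xs _ p (∧-true Pp (cong not eq)) none = Fin.suc i , q

^-distribʳ-* : ∀ q a b → (a * b) ^ q ≡ a ^ q * b ^ q
^-distribʳ-* zero    a b = refl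
^-distribʳ-* (suc q) a b = trans (cong (a * b *_) (^-distribʳ-* q a b)) ([m*n]*[o*p]≡[m*o]*[n*p] a b (a ^ q) (b ^ q))

-- Six greedy steps leave at most half of the points uncovered, since 2 · 7⁶ ≤ 8⁶.
2^q*7^6q≤8^6q : ∀ q → 2 ^ q * 7 ^ (6 * q) ≤ 8 ^ (6 * q)
2^q*7^6q≤8^6q q = begin
  2 ^ q * 7 ^ (6 * q)    ≡⟨ cong (2 ^ q *_) (^-*-assoc 7 6 q) ⟨
  2 ^ q * (7 ^ 6) ^ q    ≡⟨ ^-distribʳ-* q 2 (7 ^ 6) ⟨
  (2 * 7 ^ 6) ^ q        ≤⟨ ^-monoˡ-≤ q (≤ᵇ⇒≤ (2 * 7 ^ 6) (8 ^ 6) _) ⟩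
  (8 ^ 6) ^ q            ≡⟨ ^-*-assoc 8 6 q ⟩
  8 ^ (6 * q)            ∎
  where open ≤-Reasoning

abstract
  -- A point left over after `6q` steps would give `8^(6q) ≤ 7^(6q) · N`, and hence `2^q ≤ N`.
  cover : ∀ {N n} (D : Fin N → Fin n → Bool) (P : Fin N → Bool) → Fin n →
    (∀ p → P p ≡ true → n ≤ 8 * count (D p)) → ∀ q → N < 2 ^ q →
    ∃[ xs ] (∀ p → P p ≡ true → ∃[ i ] D p (lookup {n = 6 * q} xs i) ≡ true)
  cover {N} D P x₀ rich q small with xs , shrink ← cover-steps D P x₀ rich (6 * q)
    = xs , λ p Pp → remaining-empty D xs P p Pp (¬-not λ left →
        <-irrefl refl (<-≤-trans small (*-cancelˡ-≤ (7 ^ (6 * q)) {{m^n≢0 7 (6 * q)}} (begin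
          7 ^ (6 * q) * 2 ^ q                              ≡⟨ *-comm _ (2 ^ q) ⟩
          2 ^ q * 7 ^ (6 * q)                              ≤⟨ 2^q*7^6q≤8^6q q ⟩
          8 ^ (6 * q)                                      ≡⟨ *-identityʳ _ ⟨
          8 ^ (6 * q) * 1                                  ≤⟨ *-monoʳ-≤ (8 ^ (6 * q)) (count-pos _ p left) ⟩
          8 ^ (6 * q) * count (remaining D xs P)           ≤⟨ shrink ⟩
          7 ^ (6 * q) * count P                            ≤⟨ *-monoʳ-≤ (7 ^ (6 * q)) (count-bound P) ⟩
          7 ^ (6 * q) * N                                  ∎))))
    where open ≤-Reasoning

-- Line graphs

-- `AllPairs` relates earlier entries to later ones only, so the direction depends on the order of
-- `i` and `j`.
lookup-AllPairs : ∀ {A : Set} {R : A → A → Set} {xs : List A} → AllPairs R xs →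
                  ∀ i j → i ≢ j → R (List.lookup xs i) (List.lookup xs j) ⊎ R (List.lookup xs j) (List.lookup xs i)
lookup-AllPairs (rs ∷ _)  Fin.zero    Fin.zero    i≢j = contradiction refl i≢j
lookup-AllPairs (rs ∷ _)  Fin.zero    (Fin.suc j) _   = inj₁ (All.lookup rs (∈-lookup j))
lookup-AllPairs (rs ∷ _)  (Fin.suc i) Fin.zero    _   = inj₂ (All.lookup rs (∈-lookup i))
lookup-AllPairs (_ ∷ rss) (Fin.suc i) (Fin.suc j) i≢j = lookup-AllPairs rss i j (i≢j ∘ cong Fin.suc)

module Simple {n} (X : Adj n) (simple : IsSimple X) where

  X-sym : ∀ {u v} → X u v ≡ true → X v u ≡ true
  X-sym {u} {v} = trans (proj₂ simple v u)

  X-≢ : ∀ {u v} → X u v ≡ true → u ≢ v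
  X-≢ {u} p refl = true≢false p (proj₁ simple u)

  no-triangle : TriangleFree X → ∀ {u v w} → X u v ≡ true → X v w ≡ true → X u w ≡ true → ⊥
  no-triangle triangleFree {u} {v} {w} p q r = true≢false r (triangleFree u v w p q)

module Incidence {n m} (ends : Fin m → Fin n × Fin n) where

  -- Edges are stored as ordered pairs; admitting both orders makes this the unordered edge `uv`.
  Ends : Fin m → Fin n → Fin n → Set
  Ends e u v = ends e ≡ (u , v) ⊎ ends e ≡ (v , u)

  Inc : Fin m → Fin n → Set
  Inc e u = proj₁ (ends e) ≡ u ⊎ proj₂ (ends e) ≡ u

  Inc? : Decidable Inc
  Inc? e u = (proj₁ (ends e) ≟ u) ⊎-dec (proj₂ (ends e) ≟ u)

  Ends? : ∀ e u v → Dec (Ends e u v)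
  Ends? e u v = ≡-dec _≟_ _≟_ (ends e) (u , v) ⊎-dec ≡-dec _≟_ _≟_ (ends e) (v , u)

  ends-swap : ∀ {e u v} → Ends e u v → Ends e v u
  ends-swap = swap

  endpoints : ∀ e → ∃[ u ] ∃[ v ] Ends e u v
  endpoints e = _ , _ , inj₁ refl

  ends-incˡ : ∀ {e u v} → Ends e u v → Inc e u
  ends-incˡ (inj₁ refl) = inj₁ refl
  ends-incˡ (inj₂ refl) = inj₂ refl

  ends-incʳ : ∀ {e u v} → Ends e u v → Inc e v
  ends-incʳ = ends-incˡ ∘ ends-swap

  inc-ends : ∀ {e u} → Inc e u → ∃[ v ] Ends e u v
  inc-ends (inj₁ refl) = _ , inj₁ refl
  inc-ends (inj₂ refl) = _ , inj₂ refl

  inc-among : ∀ {e u v w} → Ends e u v → Inc e w → w ≡ u ⊎ w ≡ v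
  inc-among (inj₁ refl) (inj₁ refl) = inj₁ refl
  inc-among (inj₁ refl) (inj₂ refl) = inj₂ refl
  inc-among (inj₂ refl) (inj₁ refl) = inj₂ refl
  inc-among (inj₂ refl) (inj₂ refl) = inj₁ refl

  inc₂-ends : ∀ {e u v} → Inc e u → Inc e v → u ≢ v → Ends e u v
  inc₂-ends (inj₁ refl) (inj₁ refl) u≢v = contradiction refl u≢v
  inc₂-ends (inj₁ refl) (inj₂ refl) u≢v = inj₁ refl
  inc₂-ends (inj₂ refl) (inj₁ refl) u≢v = inj₂ refl
  inc₂-ends (inj₂ refl) (inj₂ refl) u≢v = contradiction refl u≢v

-- The interface through which all later arguments see the line graph; it hides the enumeration of
-- the edges as a list.
record IsLineGraph {n m} (X : Adj n) (L : Adj m) (ends : Fin m → Fin n × Fin n) : Set where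
  open Incidence ends
  field
    ends-adj    : ∀ {e u v} → Ends e u v → X u v ≡ true
    ends-unique : ∀ {e f u v} → Ends e u v → Ends f u v → e ≡ f
    edgeBetween : ∀ {u v} → X u v ≡ true → ∃[ e ] Ends e u v
    L-intro     : ∀ {e f w} → e ≢ f → Inc e w → Inc f w → L e f ≡ true
    L-elim      : ∀ {e f} → L e f ≡ true → e ≢ f × ∃[ w ] (Inc e w × Inc f w)

lineGraph-isLineGraph : ∀ {n} (X : Adj n) → IsSimple X → IsLineGraph X (lineGraph X) (edge X)
lineGraph-isLineGraph {n} X simple = record
  { ends-adj = ends-adj ; ends-unique = ends-unique ; edgeBetween = edgeBetween
  ; L-intro = L-intro ; L-elim = L-elim }
  where
  open Simple X simple
  open Incidence (edge X)

  L : Adj (nE X)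
  L = lineGraph X

  ordered : Fin n × Fin n → Bool
  ordered p = (toℕ (proj₁ p) <ᵇ toℕ (proj₂ p)) ∧ X (proj₁ p) (proj₂ p)

  pairs : List (Fin n × Fin n)
  pairs = concatMap (λ u → map (λ v → (u , v)) (allFin n)) (allFin n)

  edge-ordered : ∀ e → ordered (edge X e) ≡ true
  edge-ordered e = Equivalence.to T-≡ (proj₂ (∈-filter⁻ (T? ∘ ordered) {xs = pairs} (∈-lookup {xs = edges X} e)))

  edge-< : ∀ e → toℕ (proj₁ (edge X e)) < toℕ (proj₂ (edge X e))
  edge-< e = <ᵇ⇒< _ _ (Equivalence.from T-≡ (proj₁ (true-∧ (edge-ordered e))))

  edges-unique : Unique (edges X)
  edges-unique = Unique.filter⁺ (T? ∘ ordered) (Unique.concat⁺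
    (All.map⁺ (All.tabulate λ _ → Unique.map⁺ ,-injectiveʳ (Unique.allFin⁺ n)))
    (AllPairs.map⁺ (AllPairs.map rows-disjoint (Unique.allFin⁺ n))))
    where
    rows-disjoint : ∀ {u u′} → u ≢ u′ → ∀ {p} →
                    ¬ (p ∈ map (λ v → (u , v)) (allFin n) × p ∈ map (λ v → (u′ , v)) (allFin n))
    rows-disjoint u≢u′ (p∈ , p∈′) with ∈-map⁻ _ p∈ | ∈-map⁻ _ p∈′
    ... | _ , _ , refl | _ , _ , eq = u≢u′ (,-injectiveˡ eq)

  edge-injective : ∀ {e f} → edge X e ≡ edge X f → e ≡ f
  edge-injective {e} {f} eq with e ≟ f
  ... | yes e≡f = e≡f
  ... | no  e≢f = contradiction eq
    ([ (λ ne → ne) , (λ ne → ne ∘ sym) ]′ (lookup-AllPairs edges-unique e f e≢f))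

  edge-surjective : ∀ {u v} → toℕ u < toℕ v → X u v ≡ true → ∃[ e ] edge X e ≡ (u , v)
  edge-surjective {u} {v} u<v Xuv = index uv∈ , sym (lookup-index uv∈)
    where
    uv∈ : (u , v) ∈ edges X
    uv∈ = ∈-filter⁺ (T? ∘ ordered)
      (∈-concatMap⁺ _ (lose (∈-allFin u) (∈-map⁺ (u ,_) (∈-allFin v))))
      (Equivalence.from T-≡ (∧-true (Equivalence.to T-≡ (<⇒<ᵇ u<v)) Xuv))

  ends-adj : ∀ {e u v} → Ends e u v → X u v ≡ true
  ends-adj {e} (inj₁ refl) = proj₂ (true-∧ (edge-ordered e))
  ends-adj {e} (inj₂ refl) = X-sym (proj₂ (true-∧ (edge-ordered e)))

  ends-unique : ∀ {e f u v} → Ends e u v → Ends f u v → e ≡ f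
  ends-unique (inj₁ p) (inj₁ q) = edge-injective (trans p (sym q))
  ends-unique (inj₂ p) (inj₂ q) = edge-injective (trans p (sym q))
  -- Every stored pair has its smaller endpoint first, so opposite orientations cannot both occur.
  ends-unique {e} {f} (inj₁ p) (inj₂ q) = contradiction
    (subst (λ (u , v) → toℕ u < toℕ v) q (edge-< f)) (<-asym (subst (λ (u , v) → toℕ u < toℕ v) p (edge-< e)))
  ends-unique {e} {f} (inj₂ p) (inj₁ q) = contradiction
    (subst (λ (u , v) → toℕ u < toℕ v) q (edge-< f)) (<-asym (subst (λ (u , v) → toℕ u < toℕ v) p (edge-< e)))

  edgeBetween : ∀ {u v} → X u v ≡ true → ∃[ e ] Ends e u v
  edgeBetween {u} {v} Xuv with <-cmp (toℕ u) (toℕ v)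
  ... | tri< u<v _ _ = let e , p = edge-surjective u<v Xuv in e , inj₁ p
  ... | tri≈ _ u≡v _ = contradiction (toℕ-injective u≡v) (X-≢ Xuv)
  ... | tri> _ _ v<u = let e , p = edge-surjective v<u (X-sym Xuv) in e , inj₂ p

  L-intro : ∀ {e f w} → e ≢ f → Inc e w → Inc f w → L e f ≡ true
  L-intro {e} {f} e≢f i j = ∧-true (≢-not== e≢f) (meet i j)
    where
    e₁ = proj₁ (edge X e)
    e₂ = proj₂ (edge X e)
    f₁ = proj₁ (edge X f)
    f₂ = proj₂ (edge X f)
    meet : ∀ {w} → Inc e w → Inc f w → (e₁ == f₁) ∨ (e₁ == f₂) ∨ (e₂ == f₁) ∨ (e₂ == f₂) ≡ true
    meet (inj₁ p) (inj₁ q) = ∨-trueˡ (true-⌊⌋ (e₁ ≟ f₁) (trans p (sym q)))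
    meet (inj₁ p) (inj₂ q) = ∨-trueʳ {e₁ == f₁} (∨-trueˡ (true-⌊⌋ (e₁ ≟ f₂) (trans p (sym q))))
    meet (inj₂ p) (inj₁ q) = ∨-trueʳ {e₁ == f₁} (∨-trueʳ {e₁ == f₂} (∨-trueˡ (true-⌊⌋ (e₂ ≟ f₁) (trans p (sym q)))))
    meet (inj₂ p) (inj₂ q) = ∨-trueʳ {e₁ == f₁} (∨-trueʳ {e₁ == f₂} (∨-trueʳ {e₂ == f₁} (true-⌊⌋ (e₂ ≟ f₂) (trans p (sym q)))))

  L-elim : ∀ {e f} → L e f ≡ true → e ≢ f × ∃[ w ] (Inc e w × Inc f w)
  L-elim {e} {f} p with ne , meet ← true-∧ p = not==-≢ ne , shared meet
    where
    shared : _ → ∃[ w ] (Inc e w × Inc f w)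
    shared m with true-∨ m
    ... | inj₁ q = _ , inj₁ refl , inj₁ (sym (==-true q))
    ... | inj₂ m with true-∨ m
    ... | inj₁ q = _ , inj₁ refl , inj₂ (sym (==-true q))
    ... | inj₂ m with true-∨ m
    ... | inj₁ q = _ , inj₂ refl , inj₁ (sym (==-true q))
    ... | inj₂ q = _ , inj₂ refl , inj₂ (sym (==-true q))

-- Disjoint edges and the edges joining them.

module LineGraph {n m} (X : Adj n) (simple : IsSimple X) (L : Adj m)
  (ends : Fin m → Fin n × Fin n) (isLineGraph : IsLineGraph X L ends) where

  open Simple X simple public
  open Incidence ends public
  open IsLineGraph isLineGraph public

  ends-other : ∀ {e u v w} → Ends e u v → Ends e u w → v ≡ w
  ends-other {e} p q with inc-among p (ends-incʳ q)
  ... | inj₁ refl = contradiction refl (X-≢ (ends-adj q))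
  ... | inj₂ w≡v  = sym w≡v

  Disjoint : Fin m → Fin m → Set
  Disjoint e f = ∀ {w} → Inc e w → Inc f w → ⊥

  L-false⇒disjoint : ∀ {e f} → e ≢ f → L e f ≡ false → Disjoint e f
  L-false⇒disjoint e≢f p i j = true≢false (L-intro e≢f i j) p

  disjoint⇒≢ : ∀ {e f} → Disjoint e f → e ≢ f
  disjoint⇒≢ {e} dis refl with _ , _ , p ← endpoints e = dis (ends-incˡ p) (ends-incˡ p)

  disjoint⇒L-false : ∀ {e f} → Disjoint e f → L e f ≡ false
  disjoint⇒L-false dis = ¬-not λ p → let _ , _ , i , j = L-elim p in dis i j

  ends-disjoint : ∀ {e f a b c d} → Ends e a b → Ends f c d →
                  a ≢ c → a ≢ d → b ≢ c → b ≢ d → Disjoint e f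
  ends-disjoint p q a≢c a≢d b≢c b≢d i j with inc-among p i | inc-among q j
  ... | inj₁ refl | inj₁ x = a≢c x
  ... | inj₁ refl | inj₂ x = a≢d x
  ... | inj₂ refl | inj₁ x = b≢c x
  ... | inj₂ refl | inj₂ x = b≢d x

  -- The vertices that `g` shares with `e` and with `f` differ by disjointness, so they are the two
  -- ends of `g`.
  joining-ends : ∀ {e f g} → Disjoint e f → L e g ≡ true → L g f ≡ true →
                 ∃[ p ] ∃[ q ] (Inc e p × Inc f q × Ends g p q)
  joining-ends dis Leg Lgf
    with _ , p , ep , gp ← L-elim Leg
    with _ , q , gq , fq ← L-elim Lgf
    = p , q , ep , fq , inc₂-ends gp gq (λ { refl → dis ep fq })

  ends-joining : ∀ {e f g p q} → Disjoint e f → Inc e p → Inc f q → Ends g p q →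
                 L e g ∧ L g f ≡ true
  ends-joining dis ep fq gpq = ∧-true
    (L-intro (λ { refl → dis (ends-incʳ gpq) fq }) ep (ends-incˡ gpq))
    (L-intro (λ { refl → dis ep (ends-incˡ gpq) }) (ends-incʳ gpq) fq)

  module _ (triangleFree : TriangleFree X) where

    private
      -- Once `ac` is an edge, `ad` would close the triangle `acd` and `bc` the triangle `abc`. Only
      -- `ac` and `bd` remain as joining edges.
      joining-among : ∀ {e f a b c d} → Disjoint e f → Ends e a b → Ends f c d → X a c ≡ true →
        ∀ g → L e g ∧ L g f ≡ true → Ends g a c ⊎ Ends g b d
      joining-among dis p q Xac g join
        with Leg , Lgf ← true-∧ join
        with r , s , er , fs , grs ← joining-ends dis Leg Lgf
        with inc-among p er | inc-among q fs
      ... | inj₁ refl | inj₁ refl = inj₁ grs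
      ... | inj₁ refl | inj₂ refl = ⊥-elim (no-triangle triangleFree Xac (ends-adj q) (ends-adj grs))
      ... | inj₂ refl | inj₁ refl = ⊥-elim (no-triangle triangleFree (X-sym (ends-adj p)) Xac (ends-adj grs))
      ... | inj₂ refl | inj₂ refl = inj₂ grs

    common≡1 : ∀ {e f a b c d} → Disjoint e f → Ends e a b → Ends f c d →
               X a c ≡ true → X b d ≡ false → common L e f ≡ 1
    common≡1 dis p q Xac Xbd with g , gac ← edgeBetween Xac =
      count≡1 _ g (ends-joining dis (ends-incˡ p) (ends-incˡ q) gac) λ h join →
        [ (λ hac → ends-unique hac gac)
        , (λ hbd → ⊥-elim (true≢false (ends-adj hbd) Xbd)) ]′ (joining-among dis p q Xac h join)

    common≡2 : ∀ {e f a b c d} → Disjoint e f → Ends e a b → Ends f c d →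
               X a c ≡ true → X b d ≡ true → common L e f ≡ 2
    common≡2 dis p q Xac Xbd
      with g , gac ← edgeBetween Xac
      with h , hbd ← edgeBetween Xbd =
      count≡2 _ g h
        (λ { refl → [ X-≢ (ends-adj p) , (λ { refl → dis (ends-incˡ p) (ends-incʳ q) }) ]′
                      (inc-among hbd (ends-incˡ gac)) })
        (ends-joining dis (ends-incˡ p) (ends-incˡ q) gac)
        (ends-joining dis (ends-incʳ p) (ends-incʳ q) hbd)
        λ x join → [ (λ xac → inj₁ (ends-unique xac gac))
                   , (λ xbd → inj₂ (ends-unique xbd hbd)) ]′ (joining-among dis p q Xac x join)

-- From the scheme to the parameters of X

-- `joined` expresses in `X` that `L(X)` has diameter at most 2. Equivalently, every edge `ab`
-- dominates: the vertices outside `N(a) ∪ N(b)` form an independent set.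
module EdgeDominating {n k} (X : Adj n) (simple : IsSimple X) (regular : IsRegular X k)
  (triangleFree : TriangleFree X) (3≤k : 3 ≤ k)
  (joined : ∀ {a b c d} → X a b ≡ true → X c d ≡ true → a ≢ c → a ≢ d → b ≢ c → b ≢ d →
            X a c ≡ true ⊎ X a d ≡ true ⊎ X b c ≡ true ⊎ X b d ≡ true)
  (μ : ℕ)
  (paths : ∀ {a b c} → X a b ≡ true → X a c ≡ true → b ≢ c → common X b c ≡ μ) where

  open Simple X simple

  private
    nbr-≢ : ∀ {u v w} → X u w ≡ true → X u v ≡ false → w ≢ v
    nbr-≢ p q refl = true≢false p q

    false-sym : ∀ {u v} → X u v ≡ false → X v u ≡ false
    false-sym {u} {v} = trans (proj₂ simple v u)

    1≤deg : ∀ u → 1 ≤ count (X u)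
    1≤deg u = subst (1 ≤_) (sym (regular u)) (≤-trans (s≤s z≤n) 3≤k)

  -- If u and v had no common neighbour, a neighbour of u would be adjacent to u and to all of N(v).
  nonadjacent-common : ∀ {u v} → u ≢ v → X u v ≡ false → common X u v ≡ μ
  nonadjacent-common {u} {v} u≢v uv with 1 ≤? common X u v
  ... | yes pos
    with w , p ← count-∃ _ pos
    with uw , wv ← true-∧ {X u w} p = paths (X-sym uw) wv u≢v
  ... | no none with x , ux ← count-∃ (X u) (1≤deg u) = contradiction (begin-strict
      k                                         ≡⟨ regular v ⟨
      count (X v)                               ≤⟨ count-mono (λ y vy → ∧-true (adj y vy) (≢-not== (nbr-≢ vy (false-sym uv)))) ⟩
      count (λ y → X x y ∧ not (y == u))        <⟨ ≤-refl ⟩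
      suc (count (λ y → X x y ∧ not (y == u)))  ≡⟨ count-remove (X x) u (X-sym ux) ⟨
      count (X x)                               ≡⟨ regular x ⟩
      k                                         ∎) (<-irrefl refl)
    where
    open ≤-Reasoning
    no-common : ∀ {w} → X u w ≡ true → X w v ≡ true → ⊥
    no-common {w} p q = none (count-pos _ w (∧-true p q))
    adj : ∀ y → X v y ≡ true → X x y ≡ true
    -- Of the four edges that can join `ux` and `vy`, `uv` is absent, and `uy` or `xv` would yield a
    -- common neighbour of `u` and `v`; `xy` remains.
    adj y vy with joined ux vy u≢v (nbr-≢ vy (false-sym uv) ∘ sym) (nbr-≢ ux uv) (λ { refl → no-common ux (X-sym vy) })
    ... | inj₁ p               = ⊥-elim (true≢false p uv)
    ... | inj₂ (inj₁ p)        = ⊥-elim (no-common p (X-sym vy))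
    ... | inj₂ (inj₂ (inj₁ p)) = ⊥-elim (no-common ux p)
    ... | inj₂ (inj₂ (inj₂ p)) = p

  -- The common neighbours of b with c and with d are disjoint subsets of N(b).
  edge-in-nonneighbours : ∀ {b c d} → X c d ≡ true → b ≢ c → b ≢ d → X b c ≡ false → X b d ≡ false →
                          2 * μ ≤ k
  edge-in-nonneighbours {b} {c} {d} cd b≢c b≢d bc bd = begin
    2 * μ                                            ≡⟨ cong (μ +_) (+-identityʳ μ) ⟩
    μ + μ                                            ≡⟨ cong₂ _+_ (nonadjacent-common b≢c bc) (nonadjacent-common b≢d bd) ⟨
    common X b c + common X b d                      ≤⟨ +-monoʳ-≤ (common X b c) (count-mono outside) ⟩
    common X b c + count (λ w → X b w ∧ not (X w c)) ≡⟨ count-split (X b) (λ w → X w c) ⟨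
    count (X b)                                      ≡⟨ regular b ⟩
    k                                                ∎
    where
    open ≤-Reasoning
    outside : ∀ w → X b w ∧ X w d ≡ true → X b w ∧ not (X w c) ≡ true
    outside w p with bw , wd ← true-∧ {X b w} p =
      ∧-true bw (cong not (¬-not (λ wc → no-triangle triangleFree wc cd wd)))

  -- For an edge `ab`, the set `T = N(a) ∪ N(b)` has at most `2k` vertices. Its complement is
  -- independent, so all `k` edges at an outside vertex end in `T`, and counting them shows that the
  -- complement is no larger than `T`.
  n≤4k : Fin n → n ≤ 4 * k
  n≤4k a with b , ab ← count-∃ (X a) (1≤deg a) = begin
    n                                  ≡⟨ count-true n ⟨
    count {n} (λ _ → true)             ≡⟨ count-split (λ _ → true) T ⟩
    count T + count (λ s → not (T s))  ≤⟨ +-monoʳ-≤ (count T) far≤near ⟩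
    count T + count T                  ≤⟨ +-mono-≤ T≤2k T≤2k ⟩
    2 * k + 2 * k                      ≡⟨ *-distribʳ-+ k 2 2 ⟨
    4 * k                              ∎
    where
    open ≤-Reasoning
    T : Fin n → Bool
    T s = X a s ∨ X b s
    T≤2k : count T ≤ 2 * k
    T≤2k = begin
      count T                              ≡⟨ count-split T (X a) ⟩
      count (λ s → T s ∧ X a s) + count (λ s → T s ∧ not (X a s))
        ≤⟨ +-mono-≤ (count-mono (λ s p → proj₂ (true-∧ {T s} p))) (count-mono (λ s → second (X a s))) ⟩
      count (X a) + count (X b)            ≡⟨ cong₂ _+_ (regular a) (regular b) ⟩
      k + k                                ≡⟨ cong (k +_) (+-identityʳ k) ⟨
      2 * k                                ∎
      where
      second : ∀ x {y} → (x ∨ y) ∧ not x ≡ true → y ≡ true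
      second false {true} _ = refl
      second true  ()
    split-not-∨ : ∀ {x y} → not (x ∨ y) ≡ true → x ≡ false × y ≡ false
    split-not-∨ {false} {false} _ = refl , refl
    into-T : ∀ s y → not (T s) ≡ true → X s y ≡ true → T y ≡ true
    into-T s y far sy with as , bs ← split-not-∨ {X a s} far with T y in Ty
    ... | true = refl
    ... | false with ay , by ← split-not-∨ {X a y} (cong not Ty)
      with joined ab sy (nbr-≢ (X-sym ab) bs) (nbr-≢ (X-sym ab) by) (nbr-≢ ab as) (nbr-≢ ab ay)
    ... | inj₁ p               = ⊥-elim (true≢false p as)
    ... | inj₂ (inj₁ p)        = ⊥-elim (true≢false p ay)
    ... | inj₂ (inj₂ (inj₁ p)) = ⊥-elim (true≢false p bs)
    ... | inj₂ (inj₂ (inj₂ p)) = ⊥-elim (true≢false p by)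
    far≤near : count (λ s → not (T s)) ≤ count T
    far≤near = *-cancelˡ-≤ k {{>-nonZero (≤-trans (s≤s z≤n) 3≤k)}}
      (double-count 1 k k (λ s → not (T s)) T X
        (λ s far → subst₂ _≤_ (regular s) (sym (*-identityˡ _))
          (count-mono (λ y sy → ∧-true (into-T s y far sy) sy)))
        (λ y _ → subst₂ _≤_ (sym (*-identityˡ _)) (regular y)
          (count-mono (λ s p → X-sym (proj₂ (true-∧ {not (T s)} p))))))

  -- The vertices of `N(u) ∖ N(v)` all distinguish `u` and `v`. Common neighbours number 0 if `u`
  -- and `v` are adjacent and `μ` otherwise, at most `k/2` in both cases, so `n ≤ 4k ≤ 8δ`.
  distinguish-many : 2 * μ ≤ k → ∀ u v → u ≢ v → n ≤ 8 * count (distinguishes X u v)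
  distinguish-many 2μ≤k u v u≢v = begin
    n                                       ≤⟨ n≤4k u ⟩
    4 * k                                   ≤⟨ *-monoʳ-≤ 4 k≤2δ ⟩
    4 * (2 * δ)                             ≡⟨ *-assoc 4 2 δ ⟨
    8 * δ                                   ≤⟨ *-monoʳ-≤ 8 (count-mono δ⊆) ⟩
    8 * count (distinguishes X u v)         ∎
    where
    open ≤-Reasoning
    δ : ℕ
    δ = count (λ x → X u x ∧ not (X x v))
    split : k ≡ common X u v + δ
    split = trans (sym (regular u)) (count-split (X u) (λ x → X x v))
    common≤ : 2 * common X u v ≤ k
    common≤ with X u v in uv
    ... | true  = subst (λ m → 2 * m ≤ k) (sym empty) z≤n
      where
      empty : common X u v ≡ 0
      empty = trans (count-cong (λ x → ¬-not λ p →
        let ux , xv = true-∧ {X u x} p in no-triangle triangleFree ux xv uv)) (count-false n)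
    ... | false = subst (λ m → 2 * m ≤ k) (sym (nonadjacent-common u≢v uv)) 2μ≤k
    k≤2δ : k ≤ 2 * δ
    k≤2δ = +-cancelˡ-≤ k _ _ (begin
      k + k                                ≡⟨ cong (k +_) (+-identityʳ k) ⟨
      2 * k                                ≡⟨ cong (2 *_) split ⟩
      2 * (common X u v + δ)               ≡⟨ *-distribˡ-+ 2 (common X u v) δ ⟩
      2 * common X u v + 2 * δ             ≤⟨ +-monoˡ-≤ (2 * δ) common≤ ⟩
      k + 2 * δ                            ∎)
    δ⊆ : ∀ x → X u x ∧ not (X x v) ≡ true → distinguishes X u v x ≡ true
    δ⊆ x p with ux , xv ← true-∧ {X u x} p =
      ∨-trueʳ {x == u} (∨-trueʳ {x == v} (xor-true (X-sym ux) xv))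
      where
      xor-true : ∀ {a b} → a ≡ true → not b ≡ true → a xor b ≡ true
      xor-true refl q = q

-- Colours and intersection numbers of the scheme.

other-colours : ∀ i → toℕ i ≢ 0 →
  ∃[ j ] ∃[ j′ ] (toℕ j ≢ 0 × toℕ j′ ≢ 0 × j ≢ i × j′ ≢ i ×
                  (∀ (t : Fin 4) → toℕ t ≢ 0 → t ≢ i → t ≡ j ⊎ t ≡ j′))
other-colours 0F i≢0 = contradiction refl i≢0
other-colours 1F _ = 2F , 3F , (λ ()) , (λ ()) , (λ ()) , (λ ()) , λ where
  0F t≢0 _   → contradiction refl t≢0
  1F _   t≢i → contradiction refl t≢i
  2F _   _   → inj₁ refl
  3F _   _   → inj₂ refl
other-colours 2F _ = 1F , 3F , (λ ()) , (λ ()) , (λ ()) , (λ ()) , λ where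
  0F t≢0 _   → contradiction refl t≢0
  1F _   _   → inj₁ refl
  2F _   t≢i → contradiction refl t≢i
  3F _   _   → inj₂ refl
other-colours 3F _ = 1F , 2F , (λ ()) , (λ ()) , (λ ()) , (λ ()) , λ where
  0F t≢0 _   → contradiction refl t≢0
  1F _   _   → inj₁ refl
  2F _   _   → inj₂ refl
  3F _   t≢i → contradiction refl t≢i

module Scheme {n m k} (X : Adj n) (simple : IsSimple X) (regular : IsRegular X k)
  (triangleFree : TriangleFree X) (3≤k : 3 ≤ k)
  (L : Adj m) (ends : Fin m → Fin n × Fin n) (isLineGraph : IsLineGraph X L ends)
  (c : Fin m → Fin m → Fin 4) (scheme : IsAssocScheme 4 c) (diameter : HasDiameter2 c)
  (i : Fin 4) (i≢0 : toℕ i ≢ 0) (is-line : ∀ e f → constituent c i e f ≡ L e f)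
  (¬sr : ¬ StronglyRegular L) where

  open LineGraph X simple L ends isLineGraph
  open IsAssocScheme scheme

  -- As `i ≠ 0`, no diagonal pair has colour `i`, so the constituent is the whole colour class.
  L≡colour : ∀ e f → L e f ≡ (c e f == i)
  L≡colour e f = trans (sym (is-line e f)) (bool-ext (λ p → proj₂ (true-∧ p)) λ p →
    ∧-true (≢-not== λ { refl → i≢0 (trans (cong toℕ (sym (==-true p))) (zero-iff-diag₂ e)) }) p)

  L⇒colour : ∀ {e f} → L e f ≡ true → c e f ≡ i
  L⇒colour {e} {f} p = ==-true (trans (sym (L≡colour e f)) p)

  common-by-colour : ∀ {e f t} → c e f ≡ t → common L e f ≡ proj₁ (regularity i i t)
  common-by-colour {e} {f} {t} p = trans (count-cong λ w → cong₂ _∧_ (L≡colour e w) (L≡colour w f))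
                                         (proj₂ (regularity i i t) e f p)

  -- The scheme already makes `L` regular, with a constant number of common neighbours for adjacent
  -- pairs. Constancy on disjoint pairs would make it strongly regular.
  disjoint-varied : ∀ m → ¬ (∀ e f → Disjoint e f → common L e f ≡ m)
  disjoint-varied m const = ¬sr (_ , _ , m , degree , adjacent , λ e f e≢f p → const e f (L-false⇒disjoint e≢f p))
    where
    degree : IsRegular L (proj₁ (regularity i i Fin.zero))
    -- The degree is the intersection number at the diagonal colour 0: by symmetry both conditions
    -- on `w` coincide.
    degree e = trans (count-cong λ w → trans (L≡colour e w) (twice w))
                     (proj₂ (regularity i i Fin.zero) e e (toℕ-injective (zero-iff-diag₂ e)))
      where
      twice : ∀ w → (c e w == i) ≡ (c e w == i) ∧ (c w e == i)
      twice w rewrite symm w e with c e w == i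
      ... | true  = refl
      ... | false = refl
    adjacent : ∀ e f → L e f ≡ true → common L e f ≡ proj₁ (regularity i i i)
    adjacent e f p = common-by-colour (L⇒colour p)

  joined-ends : ∀ {e f} → Disjoint e f →
    ∃[ a ] ∃[ b ] ∃[ c ] ∃[ d ] (Ends e a b × Ends f c d × X a c ≡ true)
  joined-ends {e} {f} dis with proj₁ diameter i i≢0 e f
  ... | inj₁ e≡f = contradiction e≡f (disjoint⇒≢ dis)
  ... | inj₂ (inj₁ p) = ⊥-elim (true≢false (trans (sym (is-line e f)) p) (disjoint⇒L-false dis))
  ... | inj₂ (inj₂ (g , p , q))
    with a , c , ea , fc , gac ← joining-ends dis (trans (sym (is-line e g)) p) (trans (sym (is-line g f)) q)
    with b , eab ← inc-ends ea
    with d , fcd ← inc-ends fc = a , b , c , d , eab , fcd , ends-adj gac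

  joined : ∀ {a b c d} → X a b ≡ true → X c d ≡ true → a ≢ c → a ≢ d → b ≢ c → b ≢ d →
           X a c ≡ true ⊎ X a d ≡ true ⊎ X b c ≡ true ⊎ X b d ≡ true
  joined ab cd a≢c a≢d b≢c b≢d
    with e , eab ← edgeBetween ab
    with f , fcd ← edgeBetween cd
    with _ , _ , _ , _ , p , q , adj ← joined-ends (ends-disjoint eab fcd a≢c a≢d b≢c b≢d)
    with inc-among eab (ends-incˡ p) | inc-among fcd (ends-incˡ q)
  ... | inj₁ refl | inj₁ refl = inj₁ adj
  ... | inj₁ refl | inj₂ refl = inj₂ (inj₁ adj)
  ... | inj₂ refl | inj₁ refl = inj₂ (inj₂ (inj₁ adj))
  ... | inj₂ refl | inj₂ refl = inj₂ (inj₂ (inj₂ adj))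

  common≡1⊎2 : ∀ {e f} → Disjoint e f → common L e f ≡ 1 ⊎ common L e f ≡ 2
  common≡1⊎2 dis with _ , b , _ , d , eab , fcd , ac ← joined-ends dis with X b d in bd
  ... | true  = inj₂ (common≡2 triangleFree dis eab fcd ac bd)
  ... | false = inj₁ (common≡1 triangleFree dis eab fcd ac bd)

  -- Among disjoint pairs, colour `j` singles out exactly the opposite edges of 4-cycles of `X`.
  TwofoldColour : Fin 4 → Set
  TwofoldColour j = toℕ j ≢ 0 × j ≢ i × (∀ {e f} → Disjoint e f → (c e f ≡ j → common L e f ≡ 2) × (common L e f ≡ 2 → c e f ≡ j))

  disjoint-colour : ∀ {j j′ e f} → (∀ t → toℕ t ≢ 0 → t ≢ i → t ≡ j ⊎ t ≡ j′) →
                    Disjoint e f → c e f ≡ j ⊎ c e f ≡ j′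
  disjoint-colour {e = e} {f} others dis = others (c e f) (disjoint⇒≢ dis ∘ zero-iff-diag₁ e f)
    λ p → true≢false (trans (L≡colour e f) (true-⌊⌋ (c e f ≟ i) p)) (disjoint⇒L-false dis)

  private
    twofold-if : ∀ {j j′} → toℕ j ≢ 0 → j ≢ i → (∀ t → toℕ t ≢ 0 → t ≢ i → t ≡ j ⊎ t ≡ j′) →
                 proj₁ (regularity i i j) ≡ 2 → proj₁ (regularity i i j′) ≢ 2 → TwofoldColour j
    twofold-if {j} {j′} j≢0 j≢i others q≡2 q′≢2 = j≢0 , j≢i , λ dis →
      (λ eq → trans (common-by-colour eq) q≡2) ,
      λ p → [ (λ eq → eq)
            , (λ eq → contradiction (trans (sym (common-by-colour eq)) p) q′≢2) ]′
            (disjoint-colour others dis)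

  -- On disjoint pairs the number of joining edges is 1 or 2 and depends only on which of the two
  -- remaining colours occurs. If both or neither gave 2, it would be constant.
  twofold-colour : ∃[ j ] TwofoldColour j
  twofold-colour
    with j , j′ , j≢0 , j′≢0 , j≢i , j′≢i , others ← other-colours i i≢0
    with proj₁ (regularity i i j) ℕ.≟ 2 | proj₁ (regularity i i j′) ℕ.≟ 2
  ... | yes q≡2 | no q′≢2 = j , twofold-if j≢0 j≢i others q≡2 q′≢2
  ... | no q≢2 | yes q′≡2 = j′ , twofold-if j′≢0 j′≢i (λ t t≢0 t≢i → swap (others t t≢0 t≢i)) q′≡2 q≢2
  ... | yes q≡2 | yes q′≡2 = contradiction all-2 (disjoint-varied 2)
    where
    all-2 : ∀ e f → Disjoint e f → common L e f ≡ 2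
    all-2 e f dis with disjoint-colour others dis
    ... | inj₁ eq = trans (common-by-colour eq) q≡2
    ... | inj₂ eq = trans (common-by-colour eq) q′≡2
  ... | no q≢2 | no q′≢2 = contradiction all-1 (disjoint-varied 1)
    where
    all-1 : ∀ e f → Disjoint e f → common L e f ≡ 1
    all-1 e f dis with common≡1⊎2 dis | disjoint-colour others dis
    ... | inj₁ p | _         = p
    ... | inj₂ p | inj₁ eq = contradiction (trans (sym (common-by-colour eq)) p) q≢2
    ... | inj₂ p | inj₂ eq = contradiction (trans (sym (common-by-colour eq)) p) q′≢2

  coloured-disjoint : ∀ {j e f} → toℕ j ≢ 0 → j ≢ i → c e f ≡ j → Disjoint e f
  coloured-disjoint {e = e} {f} j≢0 j≢i refl = L-false⇒disjoint
    (λ { refl → j≢0 (zero-iff-diag₂ e) })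
    (trans (L≡colour e f) (false-⌊⌋ (c e f ≟ i) j≢i))

  private
    j : Fin 4
    j = proj₁ twofold-colour

    j-twofold : TwofoldColour j
    j-twofold = proj₂ twofold-colour

  -- The intersection number omits the common neighbour `a` from which the two edges start; the
  -- successor restores it.
  μ : ℕ
  μ = suc (proj₁ (regularity i j i))

  -- For e = ab and f = ac, the edges g adjacent to e with c(g, f) = j are
  -- the edges bd with d ≠ a a common neighbour of b and c.
  paths : ∀ {a b c} → X a b ≡ true → X a c ≡ true → b ≢ c → common X b c ≡ μ
  paths {a} {b} {v} ab av b≢v
    with e , eab ← edgeBetween ab
    with f , fav ← edgeBetween av =
    trans (count-remove (λ d → X b d ∧ X d v) a (∧-true (X-sym ab) av)) (cong suc (trans
      (≤-antisym
        (count-injection (λ d g → Ends? g b d) to-edge (λ _ _ _ → ends-other))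
        (count-injection (λ g d → Ends? g b d) to-vertex (λ _ _ _ → ends-unique)))
      (proj₂ (regularity i j i) e f
        (L⇒colour (L-intro (λ { refl → b≢v (ends-other eab fav) }) (ends-incˡ eab) (ends-incˡ fav))))))
    where
    a≢b = X-≢ ab

    square : Fin n → Bool
    square d = (X b d ∧ X d v) ∧ not (d == a)

    coloured : Fin m → Bool
    coloured g = (c e g == i) ∧ (c g f == j)

    to-edge : ∀ d → square d ≡ true → ∃[ g ] (coloured g ≡ true × Ends g b d)
    to-edge d p
      with bdv , ne ← true-∧ {X b d ∧ X d v} p
      with bd , dv ← true-∧ {X b d} bdv
      with g , gbd ← edgeBetween bd =
      g , ∧-true
        (trans (sym (L≡colour e g)) (L-intro (λ { refl → d≢a (ends-other gbd (ends-swap eab)) }) (ends-incʳ eab) (ends-incˡ gbd)))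
        (true-⌊⌋ (c g f ≟ j) (proj₂ (proj₂ (proj₂ j-twofold) dis)
          (common≡2 triangleFree dis gbd fav (X-sym ab) dv)))
      , gbd
      where
      d≢a = not==-≢ ne
      dis : Disjoint g f
      dis = ends-disjoint gbd fav (a≢b ∘ sym) b≢v d≢a (X-≢ dv)

    to-vertex : ∀ g → coloured g ≡ true → ∃[ d ] (square d ≡ true × Ends g b d)
    to-vertex g p
      with ei , gj ← true-∧ {c e g == i} p
      with _ , w , ew , gw ← L-elim (trans (L≡colour e g) ei)
      with inc-among eab ew
    -- Meeting `e` at `a` would make `g` meet `f` there too, although colour `j` forces them to be
    -- disjoint.
    ... | inj₁ refl = ⊥-elim (dis gw (ends-incˡ fav))
      where
      dis : Disjoint g f
      dis = coloured-disjoint (proj₁ j-twofold) (proj₁ (proj₂ j-twofold)) (==-true gj)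
    ... | inj₂ refl with d , gbd ← inc-ends gw = d , ∧-true (∧-true (ends-adj gbd) dv) (≢-not== d≢a) , gbd
      where
      dis : Disjoint g f
      dis = coloured-disjoint (proj₁ j-twofold) (proj₁ (proj₂ j-twofold)) (==-true gj)
      d≢a : d ≢ a
      d≢a refl = dis (ends-incʳ gbd) (ends-incˡ fav)
      dv : X d v ≡ true
      dv with X d v in eq
      ... | true  = refl
      -- Without the edge `dv`, only `ba` would join `g` to `f`, but colour `j` demands two joining
      -- edges.
      ... | false = contradiction
        (trans (sym (common≡1 triangleFree dis gbd fav (X-sym ab) eq))
               (proj₁ (proj₂ (proj₂ j-twofold) dis) (==-true gj)))
        λ ()

  open EdgeDominating X simple regular triangleFree 3≤k joined μ paths public

  -- Otherwise no vertex b is nonadjacent to both ends of an edge cd avoiding b, and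
  -- then any two disjoint edges are joined by exactly two edges.
  2μ≤k : 2 * μ ≤ k
  2μ≤k with 2 * μ ≤? k
  ... | yes p = p
  ... | no ¬p = contradiction all-2 (disjoint-varied 2)
    where
    all-2 : ∀ e f → Disjoint e f → common L e f ≡ 2
    all-2 e f dis with a , b , v , d , eab , fvd , av ← joined-ends dis with X b d in bd
    ... | true  = common≡2 triangleFree dis eab fvd av bd
    ... | false = contradiction
      (edge-in-nonneighbours (ends-adj fvd)
        (λ { refl → dis (ends-incʳ eab) (ends-incˡ fvd) })
        (λ { refl → dis (ends-incʳ eab) (ends-incʳ fvd) })
        (triangleFree b a v (X-sym (ends-adj eab)) av) bd) ¬p

  distinguished : ∀ u v → u ≢ v → n ≤ 8 * count (distinguishes X u v)
  distinguished = distinguish-many 2μ≤k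

-- Automorphisms

xor-self : ∀ {a b} → a ≡ b → a xor b ≡ true → ⊥
xor-self {true}  refl ()
xor-self {false} refl ()

-- Pulling adjacency back along `φ` and along `ψ` shows that `x` sees `u` exactly as it sees `v`;
-- injectivity excludes `x = u` and `x = v`.
agreement-indistinct : ∀ {n} {X : Adj n} {φ ψ : Fin n → Fin n} → IsAut X φ → IsAut X ψ →
  ∀ {u v x} → φ u ≡ ψ v → u ≢ v → φ x ≡ ψ x → distinguishes X u v x ≡ true → ⊥
agreement-indistinct {X = X} {φ} {ψ} (φ-inj , φ-adj) (ψ-inj , ψ-adj) {u} {v} {x} φu≡ψv u≢v agree d
  with true-∨ d
... | inj₁ x==u with refl ← ==-true {u = x} {v = u} x==u = u≢v (ψ-inj (trans (sym agree) φu≡ψv))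
... | inj₂ d′ with true-∨ d′
... | inj₁ x==v with refl ← ==-true {u = x} {v = v} x==v = u≢v (φ-inj (trans φu≡ψv (sym agree)))
... | inj₂ xor = xor-self (begin
  X x u           ≡⟨ φ-adj x u ⟨
  X (φ x) (φ u)   ≡⟨ cong₂ X agree φu≡ψv ⟩
  X (ψ x) (ψ v)   ≡⟨ ψ-adj x v ⟩
  X x v           ∎) xor
  where open ≡-Reasoning

-- Take `v` with `ψ v = φ u`. If `v ≠ u`, a base vertex distinguishes them, which agreement on the
-- base forbids.
agree-on-base : ∀ {n t} {X : Adj n} (xs : Vec (Fin n) t) →
  (∀ u v → u ≢ v → ∃[ i ] distinguishes X u v (lookup xs i) ≡ true) →
  ∀ {φ ψ} → IsAut X φ → IsAut X ψ → (∀ i → φ (lookup xs i) ≡ ψ (lookup xs i)) → ∀ u → φ u ≡ ψ u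
agree-on-base {X = X} xs base {φ} {ψ} φ-aut ψ-aut agree u
  with v , ψv≡φu ← injective⇒surjective ψ (proj₁ ψ-aut) (φ u)
  with u ≟ v
... | yes refl = sym ψv≡φu
... | no u≢v with i , d ← base u v u≢v =
  ⊥-elim (agreement-indistinct φ-aut ψ-aut (sym ψv≡φu) u≢v (agree i) d)

-- Greedy covering of the pairs `u ≠ v`, coded in `Fin (n * n)`, by the vertices that distinguish
-- them. Since `n * n < 2 ^ (2ℓ + 1)`, the covering bound applies with `q = 2ℓ + 1`.
small-base : ∀ {n} (X : Adj n) → Fin n →
  (∀ u v → u ≢ v → n ≤ 8 * count (distinguishes X u v)) →
  ∃[ xs ] ∀ u v → u ≢ v →
    ∃[ i ] distinguishes X u v (lookup {n = 6 * suc (⌈log₂ n ⌉ + ⌈log₂ n ⌉)} xs i) ≡ true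
small-base {n} X x₀ many = xs , found
  where
  ℓ : ℕ
  ℓ = ⌈log₂ n ⌉
  D : Fin (n * n) → Fin n → Bool
  D p = distinguishes X (proj₁ (remQuot {n} n p)) (proj₂ (remQuot {n} n p))
  P : Fin (n * n) → Bool
  P p = not (proj₁ (remQuot {n} n p) == proj₂ (remQuot {n} n p))
  open ≤-Reasoning
  small : n * n < 2 ^ suc (ℓ + ℓ)
  small = begin-strict
    n * n            ≤⟨ *-mono-≤ (n≤2^⌈log₂n⌉ n) (n≤2^⌈log₂n⌉ n) ⟩
    2 ^ ℓ * 2 ^ ℓ    ≡⟨ ^-distribˡ-+-* 2 ℓ ℓ ⟨
    2 ^ (ℓ + ℓ)      <⟨ ^-monoʳ-< 2 (s≤s (s≤s z≤n)) (n<1+n (ℓ + ℓ)) ⟩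
    2 ^ suc (ℓ + ℓ)  ∎
  covering : ∃[ xs ] (∀ p → P p ≡ true → ∃[ i ] D p (lookup {n = 6 * suc (ℓ + ℓ)} xs i) ≡ true)
  covering = cover D P x₀ (λ p Pp → many _ _ (not==-≢ Pp)) (suc (ℓ + ℓ)) small
  xs : Vec (Fin n) (6 * suc (ℓ + ℓ))
  xs = proj₁ covering
  found : ∀ u v → u ≢ v → ∃[ i ] distinguishes X u v (lookup xs i) ≡ true
  found u v u≢v
    with i , d ← proj₂ covering (combine u v)
      (subst (λ p → not (proj₁ p == proj₂ p) ≡ true) (sym (remQuot-combine u v)) (≢-not== u≢v))
    = i , subst (λ p → distinguishes X (proj₁ p) (proj₂ p) (lookup xs i) ≡ true) (remQuot-combine u v) d

-- A fixed vertex cannot distinguish `u` from `φ u`, so every vertex that does is moved.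
moves-many : ∀ {n} {X : Adj n} → (∀ u v → u ≢ v → n ≤ 8 * count (distinguishes X u v)) →
  ∀ {φ} → IsAut X φ → ∀ {u} → φ u ≢ u → n ≤ 8 * count (λ x → not (φ x == x))
moves-many {X = X} many {φ} φ-aut {u} φu≢u = ≤-trans (many u (φ u) (φu≢u ∘ sym))
  (*-monoʳ-≤ 8 (count-mono {f = distinguishes X u (φ u)} moved))
  where
  moved : ∀ x → distinguishes X u (φ u) x ≡ true → not (φ x == x) ≡ true
  moved x d = ≢-not== λ fixed → agreement-indistinct {φ = φ} {ψ = λ y → y} φ-aut
    ((λ eq → eq) , λ _ _ → refl) refl (φu≢u ∘ sym) fixed d

-- Whitney's theorem for line graphs in the regular triangle-free case of degree at least 3:
-- automorphisms of `L` are induced by automorphisms of `X`.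
module Whitney {n m k} (X : Adj n) (simple : IsSimple X) (regular : IsRegular X k)
  (triangleFree : TriangleFree X) (3≤k : 3 ≤ k)
  (L : Adj m) (ends : Fin m → Fin n × Fin n) (isLineGraph : IsLineGraph X L ends) where

  open LineGraph X simple L ends isLineGraph

  private
    3≤deg : ∀ u → 3 ≤ count (X u)
    3≤deg u = subst (3 ≤_) (sym (regular u)) 3≤k

  module _ {σ : Fin m → Fin m} (σ-aut : IsAut L σ) where

    private
      σ-inj : Injective _≡_ _≡_ σ
      σ-inj = proj₁ σ-aut

    abstract
      -- Two edges at u have images wp, wq; the image of a third edge at u meets both, and
      -- if it avoided w it would be pq, closing a triangle.
      star-image : ∀ u → ∃[ w ] (∀ {e} → Inc e u → Inc (σ e) w)
      star-image u
        with b , ub ← count-∃ (X u) (≤-trans (s≤s z≤n) (3≤deg u))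
        with b′ , ub′ , b′≢b ← count-∃₁ (X u) b (≤-trans (s≤s (s≤s z≤n)) (3≤deg u))
        with e₁ , p₁ ← edgeBetween ub
        with e₂ , p₂ ← edgeBetween ub′
        with ne , w , i₁ , i₂ ← L-elim (trans (proj₂ σ-aut e₁ e₂)
               (L-intro (λ { refl → b′≢b (ends-other p₂ p₁) }) (ends-incˡ p₁) (ends-incˡ p₂)))
        with p , q₁ ← inc-ends i₁
        with q , q₂ ← inc-ends i₂ = w , image
        where
        meets : ∀ {e e′} → Inc e u → Inc e′ u → e ≢ e′ → ∃[ x ] (Inc (σ e) x × Inc (σ e′) x)
        meets {e} {e′} i i′ e≢e′ = proj₂ (L-elim (trans (proj₂ σ-aut e e′) (L-intro e≢e′ i i′)))
        image : ∀ {e} → Inc e u → Inc (σ e) w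
        image {e} i with e ≟ e₁ | e ≟ e₂
        ... | yes refl | _        = i₁
        ... | no _     | yes refl = i₂
        ... | no e≢e₁  | no e≢e₂
          with x , ex , e₁x ← meets i (ends-incˡ p₁) e≢e₁
          with y , ey , e₂y ← meets i (ends-incˡ p₂) e≢e₂
          with inc-among q₁ e₁x | inc-among q₂ e₂y
        ... | inj₁ refl | _         = ex
        ... | inj₂ _    | inj₁ refl = ey
        ... | inj₂ refl | inj₂ refl = ⊥-elim (no-triangle triangleFree (ends-adj q₁)
          (ends-adj (inc₂-ends ex ey (λ { refl → ne (ends-unique q₁ q₂) }))) (ends-adj q₂))

    vertexMap : Fin n → Fin n
    vertexMap u = proj₁ (star-image u)

    -- If `u ≠ v` had the same image, disjoint edges `ux` and `vy` would have images sharing an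
    -- endpoint. Degree 3 leaves room for `y` to avoid both `u` and `x`.
    vertexMap-injective : Injective _≡_ _≡_ vertexMap
    vertexMap-injective {u} {v} φu≡φv with u ≟ v
    ... | yes u≡v = u≡v
    ... | no u≢v
      with x , ux , x≢v ← count-∃₁ (X u) v (≤-trans (s≤s (s≤s z≤n)) (3≤deg u))
      with y , vy , y≢u , y≢x ← count-∃₂ (X v) u x (3≤deg v)
      with e , eux ← edgeBetween ux
      with f , fvy ← edgeBetween vy =
      ⊥-elim (true≢false
        (trans (sym (proj₂ σ-aut e f)) (L-intro (disjoint⇒≢ dis ∘ σ-inj)
          (proj₂ (star-image u) (ends-incˡ eux))
          (subst (Inc (σ f)) (sym φu≡φv) (proj₂ (star-image v) (ends-incˡ fvy)))))
        (disjoint⇒L-false dis))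
      where
      dis : Disjoint e f
      dis = ends-disjoint eux fvy u≢v (y≢u ∘ sym) x≢v (y≢x ∘ sym)

    vertexMap-ends : ∀ {e u v} → Ends e u v → Ends (σ e) (vertexMap u) (vertexMap v)
    vertexMap-ends {e} {u} {v} p = inc₂-ends (proj₂ (star-image u) (ends-incˡ p))
      (proj₂ (star-image v) (ends-incʳ p)) (X-≢ (ends-adj p) ∘ vertexMap-injective)

    vertexMap-aut : IsAut X vertexMap
    vertexMap-aut = vertexMap-injective , λ u v → bool-ext (reflects u v) (preserves u v)
      where
      preserves : ∀ u v → X u v ≡ true → X (vertexMap u) (vertexMap v) ≡ true
      preserves u v uv with e , p ← edgeBetween uv = ends-adj (vertexMap-ends p)
      reflects : ∀ u v → X (vertexMap u) (vertexMap v) ≡ true → X u v ≡ true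
      reflects u v φuφv
        with g , q ← edgeBetween φuφv
        -- The edge between the images is `σ e` for some `e = xy`, so `u` and `v` must be `x` and
        -- `y` in some order.
        with e , refl ← injective⇒surjective σ σ-inj g
        with x , y , p ← endpoints e
        with inc-among (vertexMap-ends p) (ends-incˡ q) | inc-among (vertexMap-ends p) (ends-incʳ q)
      ... | inj₁ ux | inj₁ vx = contradiction (trans ux (sym vx)) (X-≢ φuφv)
      ... | inj₁ ux | inj₂ vy = subst₂ (λ a b → X a b ≡ true)
        (sym (vertexMap-injective ux)) (sym (vertexMap-injective vy)) (ends-adj p)
      ... | inj₂ uy | inj₁ vx = subst₂ (λ a b → X a b ≡ true)
        (sym (vertexMap-injective uy)) (sym (vertexMap-injective vx)) (X-sym (ends-adj p))
      ... | inj₂ uy | inj₂ vy = contradiction (trans uy (sym vy)) (X-≢ φuφv)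

  vertexMap-faithful : ∀ {σ τ} (σ-aut : IsAut L σ) (τ-aut : IsAut L τ) →
    (∀ u → vertexMap σ-aut u ≡ vertexMap τ-aut u) → ∀ e → σ e ≡ τ e
  vertexMap-faithful {σ} {τ} σ-aut τ-aut agree e with u , v , p ← endpoints e =
    ends-unique (subst₂ (Ends (σ e)) (agree u) (agree v) (vertexMap-ends σ-aut p)) (vertexMap-ends τ-aut p)

  -- An automorphism is coded by the images of the base vertices under its vertex map, a function
  -- from `6(2ℓ + 1)` positions to `n` values.
  aut-bound : 2 ≤ n → (∀ u v → u ≢ v → n ≤ 8 * count (distinguishes X u v)) →
              AutBound L (n ^ (18 * ⌈log₂ n ⌉))
  aut-bound 2≤n many σs auts distinct
    with xs , base ← small-base X (fromℕ< 2≤n) many = begin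
    length σs                     ≤⟨ injective⇒≤ (λ {s} {s′} → code-injective s s′) ⟩
    n ^ (6 * suc (ℓ + ℓ))         ≤⟨ ^-monoʳ-≤ n {{>-nonZero (≤-trans (s≤s z≤n) 2≤n)}} exponent ⟩
    n ^ (18 * ℓ)                  ∎
    where
    open ≤-Reasoning
    ℓ : ℕ
    ℓ = ⌈log₂ n ⌉
    1≤ℓ : 1 ≤ ℓ
    1≤ℓ with ℓ | n≤2^⌈log₂n⌉ n
    ... | zero  | n≤1 = contradiction (≤-trans 2≤n n≤1) λ { (s≤s ()) }
    ... | suc _ | _   = s≤s z≤n
    -- `n ≥ 2` gives `ℓ ≥ 1`, which absorbs the additive 1 into a third copy of `ℓ`.
    exponent : 6 * suc (ℓ + ℓ) ≤ 18 * ℓ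
    exponent = begin
      6 * (1 + (ℓ + ℓ))    ≤⟨ *-monoʳ-≤ 6 (+-monoˡ-≤ (ℓ + ℓ) 1≤ℓ) ⟩
      6 * (ℓ + (ℓ + ℓ))    ≡⟨ solve 1 (λ l → con 6 :* (l :+ (l :+ l)) := con 18 :* l) refl ℓ ⟩
      18 * ℓ               ∎
      where open +-*-Solver
    aut : ∀ s → IsAut L (List.lookup σs s)
    aut s = All.lookup auts (∈-lookup s)
    images : Fin (length σs) → Fin (6 * suc (ℓ + ℓ)) → Fin n
    images s i = vertexMap (aut s) (lookup xs i)
    code : Fin (length σs) → Fin (n ^ (6 * suc (ℓ + ℓ)))
    code s = funToFin (images s)
    code-injective : ∀ s s′ → code s ≡ code s′ → s ≡ s′
    code-injective s s′ eq with s ≟ s′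
    ... | yes s≡s′ = s≡s′
    ... | no s≢s′ = ⊥-elim ([ (λ (x , ne) → ne (same x)) , (λ (x , ne) → ne (sym (same x))) ]′
                              (lookup-AllPairs distinct s s′ s≢s′))
      where
      same : ∀ e → List.lookup σs s e ≡ List.lookup σs s′ e
      same = vertexMap-faithful (aut s) (aut s′)
        (agree-on-base xs base (vertexMap-aut (aut s)) (vertexMap-aut (aut s′)) λ i →
          trans (sym (finToFun-funToFin (images s) i))
            (trans (cong (λ z → finToFun z i) eq) (finToFun-funToFin (images s′) i)))

  handshake : 2 * m ≤ k * n
  handshake = subst₂ (λ a b → 2 * a ≤ k * b) (count-true (m)) (count-true n)
    (double-count 1 2 k (λ _ → true) (λ _ → true) (λ e u → ⌊ Inc? e u ⌋)
      (λ e _ → subst (2 ≤_) (sym (*-identityˡ _)) (two-ends e))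
      (λ u _ → subst₂ _≤_ (sym (*-identityˡ _)) (regular u)
        (count-injection (λ e v → Ends? e u v)
          (λ e p → let v , q = inc-ends (⌊⌋-true (Inc? e u) p) in v , ends-adj q , q)
          (λ _ _ _ → ends-unique))))
    where
    two-ends : ∀ e → 2 ≤ count (λ u → ⌊ Inc? e u ⌋)
    two-ends e with u , v , p ← endpoints e =
      2≤count _ u v (X-≢ (ends-adj p)) (true-⌊⌋ (Inc? e u) (ends-incˡ p)) (true-⌊⌋ (Inc? e v) (ends-incʳ p))

  -- A fixed edge at a moved vertex `u` must end in `φ u`, so `u` lies on at least `k - 1` moved
  -- edges, each counted at most twice. With `k ≤ 2(k - 1)` this gives `2m ≤ kn ≤ 16(k - 1) · movedV
  -- ≤ 32 · movedE`.
  motion : (∀ u v → u ≢ v → n ≤ 8 * count (distinguishes X u v)) → MotionAtLeastFrac L 16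
  motion many σ σ-aut (e₀ , σe₀≢e₀) = *-cancelˡ-≤ 2 (begin
    2 * m                       ≤⟨ handshake ⟩
    k * n                          ≤⟨ *-mono-≤ k≤2k′ n≤8moved ⟩
    2 * k′ * (8 * count movedV)    ≡⟨ solve 2 (λ a b → con 2 :* a :* (con 8 :* b) := con 16 :* (a :* b)) refl k′ (count movedV) ⟩
    16 * (k′ * count movedV)       ≤⟨ *-monoʳ-≤ 16 incidences ⟩
    16 * (2 * count movedE)        ≡⟨ solve 1 (λ a → con 16 :* (con 2 :* a) := con 2 :* (con 16 :* a)) refl (count movedE) ⟩
    2 * (16 * count movedE)        ∎)
    where
    open ≤-Reasoning
    open +-*-Solver
    k′ : ℕ
    k′ = k ∸ 1
    φ : Fin n → Fin n
    φ = vertexMap σ-aut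
    movedV : Fin n → Bool
    movedV u = not (φ u == u)
    movedE : Fin m → Bool
    movedE e = not (σ e == e)
    k≤2k′ : k ≤ 2 * k′
    k≤2k′ = begin
      k             ≡⟨ m+[n∸m]≡n (≤-trans (s≤s z≤n) 3≤k) ⟨
      1 + k′        ≤⟨ +-monoˡ-≤ k′ (≤-trans (s≤s z≤n) (∸-monoˡ-≤ 1 3≤k)) ⟩
      k′ + k′       ≡⟨ cong (k′ +_) (+-identityʳ k′) ⟨
      2 * k′        ∎
    n≤8moved : n ≤ 8 * count movedV
    -- An edge with both ends fixed is fixed, so `e₀` has a moved end.
    n≤8moved with u , v , p ← endpoints e₀ with φ u ≟ u | φ v ≟ v
    ... | no φu≢u  | _        = moves-many many (vertexMap-aut σ-aut) φu≢u
    ... | yes _    | no φv≢v  = moves-many many (vertexMap-aut σ-aut) φv≢v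
    ... | yes φu≡u | yes φv≡v = contradiction
      (ends-unique (subst₂ (Ends (σ e₀)) φu≡u φv≡v (vertexMap-ends σ-aut p)) p) σe₀≢e₀
    fixed-edge : ∀ {e u v} → φ u ≢ u → Ends e u v → σ e ≡ e → v ≡ φ u
    fixed-edge {e} {u} φu≢u p fixed
      with inc-among p (subst (λ f → Inc f (φ u)) fixed (ends-incˡ (vertexMap-ends σ-aut p)))
    ... | inj₁ φu≡u = contradiction φu≡u φu≢u
    ... | inj₂ φu≡v = sym φu≡v
    moved-star : ∀ u → φ u ≢ u → k′ ≤ count (λ e → movedE e ∧ ⌊ Inc? e u ⌋)
    moved-star u φu≢u = ≤-trans
      (∸-monoˡ-≤ 1 (subst (_≤ 1 + count (λ v → X u v ∧ not (v == φ u))) (regular u) (count-remove-≤ (X u) (φ u))))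
      (count-injection (λ v e → Ends? e u v)
        (λ v p → let uv , v≢φu = true-∧ {X u v} p
                     e , q = edgeBetween uv
                 in e , ∧-true (≢-not== (not==-≢ v≢φu ∘ fixed-edge φu≢u q)) (true-⌊⌋ (Inc? e u) (ends-incˡ q)) , q)
        (λ _ _ _ → ends-other))
    incidences : k′ * count movedV ≤ 2 * count movedE
    incidences = double-count 1 k′ 2 movedV movedE (λ u e → ⌊ Inc? e u ⌋)
      (λ u moved → subst (k′ ≤_) (sym (*-identityˡ _)) (moved-star u (not==-≢ moved)))
      (λ e _ → let u , v , p = endpoints e in subst (_≤ 2) (sym (*-identityˡ _))
        (count≤2 _ u v λ w q → inc-among p (⌊⌋-true (Inc? e w) (proj₂ (true-∧ {movedV w} q)))))

theorem5p11 :
  ∃[ C ] ∀ (n k : ℕ) (X : Adj n) →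
    IsSimple X → Connected X → IsRegular X k → TriangleFree X →
    5 ≤ n → 3 ≤ k →
    (c : Fin (nE X) → Fin (nE X) → Fin 4) →
    IsAssocScheme 4 c → HasDiameter2 c →
    (∃[ i ] (toℕ i ≢ 0 × (∀ e f → constituent c i e f ≡ lineGraph X e f))) →
    ¬ StronglyRegular (lineGraph X) →
    ((∀ u v → u ≢ v → n ≤ 8 * count (distinguishes X u v)) ×
     AutBound (lineGraph X) (n ^ (C * ⌈log₂ n ⌉)) ×
     MotionAtLeastFrac (lineGraph X) 16)
-- 18 is 6 greedy steps per halving times at most `3ℓ` halvings.
theorem5p11 = 18 , λ n k X simple _ regular triangleFree 5≤n 3≤k c scheme diameter (i , i≢0 , is-line) ¬sr →
  let isLineGraph = lineGraph-isLineGraph X simple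
      module W = Whitney X simple regular triangleFree 3≤k (lineGraph X) (edge X) isLineGraph
      many = Scheme.distinguished X simple regular triangleFree 3≤k
               (lineGraph X) (edge X) isLineGraph c scheme diameter i i≢0 is-line ¬sr
  in many , W.aut-bound (≤-trans (s≤s (s≤s z≤n)) 5≤n) many , W.motion many
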